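{- $\widetilde{r}_{ind}(\sigma_{k,\ell}) = \Theta(k^2\ell)$; that is, there are absolute constants $c, C>0$ such that $c\,k^2\ell \le \widetilde{r}_{ind}(\sigma_{k,\ell}) \le C\,k^2\ell$ for all integers $k\ge 3$ and $\ell \ge 2$.
   Context: For integers $k\ge3$ and $\ell\ge2$, the spider $\sigma_{k,\ell}$ is the tree formed as the union of $k$ paths, each of length $\ell$ (i.e. $\ell$ edges), that share exactly one common endpoint. The online Ramsey game for a target graph $H$ is played between Builder and Painter on an infinite set of vertices, initially with no edges. In each round Builder adds a new edge between two vertices (forming the background graph $G$), and Painter immediately colors that edge red or blue. The induced online Ramsey number $\widetilde{r}_{ind}(H)$ is the minimum number $m$ such that Builder has a strategy guaranteeing that, against any Painter strategy, after at most $m$ rounds there is a monochromatic induced copy of $H$ in $G$, i.e. a vertex set $S$ such that the subgraph of $G$ induced on $S$ is isomorphic to $H$ and all its edges have the same color. -}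

module Defs where

open import Data.Nat using (ℕ; zero; suc)
open import Data.Fin using (Fin; toℕ)
open import Data.Bool using (Bool)
open import Data.Product using (Σ; ∃; _×_; _,_)
open import Data.Sum using (_⊎_)
open import Data.List using (List; _∷_; [])
open import Data.List.Membership.Propositional using (_∈_)
open import Relation.Binary.PropositionalEquality using (_≡_; _≢_)
open import Relation.Nullary using (¬_)
open import Function.Definitions using (Injective)

Colour : Set
Colour = Bool

-- A position of the online Ramsey game: the list of edges built so far on the
-- vertex set ℕ, each with the colour Painter gave it.
Position : Set
Position = List (ℕ × ℕ × Colour)

Col : Position → ℕ → ℕ → Colour → Set
Col P x y c = ((x , y , c) ∈ P) ⊎ ((y , x , c) ∈ P)

Adj : Position → ℕ → ℕ → Set
Adj P x y = ∃ λ c → Col P x y c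

MonoInducedCopy : (V : Set) → (V → V → Set) → Position → Set
MonoInducedCopy V E P =
  Σ Colour λ c → Σ (V → ℕ) λ f →
    Injective _≡_ _≡_ f ×
    (∀ u v → E u v → Col P (f u) (f v) c) ×
    (∀ u v → Adj P (f u) (f v) → E u v)

-- BuilderWins V E m P : from position P, Builder has a strategy that, against
-- every Painter, yields a monochromatic induced copy of H within at most m
-- further rounds. In each round Builder adds a new edge xy (x ≠ y, not yet
-- present) and Painter colours it with either colour.
data BuilderWins (V : Set) (E : V → V → Set) : ℕ → Position → Set where
  done : ∀ {m P} → MonoInducedCopy V E P → BuilderWins V E m P
  step : ∀ {m P} (x y : ℕ) → x ≢ y → ¬ Adj P x y →
         (∀ (c : Colour) → BuilderWins V E m ((x , y , c) ∷ P)) →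
         BuilderWins V E (suc m) P

-- Spider σ_{k,ℓ}: a centre plus k legs, each a path with ℓ further vertices.
-- leg i j is the vertex at distance j+1 from the centre on leg i.
data SpiderV (k ℓ : ℕ) : Set where
  centre : SpiderV k ℓ
  leg    : Fin k → Fin ℓ → SpiderV k ℓ

data SpiderArc {k ℓ : ℕ} : SpiderV k ℓ → SpiderV k ℓ → Set where
  root : (i : Fin k) (j : Fin ℓ) → toℕ j ≡ 0 → SpiderArc centre (leg i j)
  next : (i : Fin k) (j j′ : Fin ℓ) → suc (toℕ j) ≡ toℕ j′ → SpiderArc (leg i j) (leg i j′)

SpiderAdj : (k ℓ : ℕ) → SpiderV k ℓ → SpiderV k ℓ → Set
SpiderAdj k ℓ u v = SpiderArc u v ⊎ SpiderArc v u

-- Builder can force a monochromatic induced σ_{k,ℓ} in at most m rounds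
-- from the empty graph, i.e.  r̃_ind(σ_{k,ℓ}) ≤ m.
IndOnlineRamseyAtMost : ℕ → ℕ → ℕ → Set
IndOnlineRamseyAtMost k ℓ m = BuilderWins (SpiderV k ℓ) (SpiderAdj k ℓ) m []

{-# OPTIONS --safe #-}
module Submission where

-- Lower bound. Painter colours an edge red as long as this keeps all red degrees below k. There is then no
-- red spider, and every blue edge has an endpoint of red degree k − 1; a blue spider contains k ⌊ℓ/2⌋ disjoint
-- edges, so there are at least k ⌊ℓ/2⌋ (k − 1) / 2 red ones.
--
-- Upper bound. Builder first forces a long monochromatic induced path, say a blue one, by a depth-first search:
-- a red induced path (the stack) and a blue induced path (the spine) whose vertices carry unused blue leaves are
-- kept apart, and the top u of the stack is joined to a leaf d at the end of the spine. The endpoint whose role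
-- this answer settles (d if red, u if blue) is joined to six new vertices. A red answer among them lengthens the
-- stack; otherwise that endpoint extends the spine, and its six new leaves pay for the stack vertices given up.
-- The path of length O(k²ℓ) is then cut into 4k² segments. A vertex joined to 2k segments either is the centre
-- of a blue spider or has k red neighbours u₁ … u_k; a new hub joined to all of these either is again the centre
-- of a blue spider or is joined in red to some uₐ, which lengthens a red leg by two edges at the cost of 3k rounds.
--
-- Inducedness is controlled by assigning to every vertex a role such that adjacent vertices have adjacent roles
-- in a fixed graph of roles: a set of vertices whose roles induce a path (or spider) there induces no more edges.

open import Defs
open import Data.Nat using (ℕ; zero; suc; pred; _+_; _*_; _∸_; _≤_; _<_; _>_; _≥_; z≤n; s≤s; _<?_; _≤?_; NonZero; _/_; _%_; _≡ᵇ_; ⌊_/2⌋)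
open import Data.Product using (Σ; ∃; _×_; _,_; proj₁; proj₂)
import Data.Nat.Properties as ℕ
import Data.Nat.DivMod as ℕ
open import Data.Nat.Divisibility using (n∣m*n)
open import Data.Nat.Tactic.RingSolver using (solve-∀)
open import Data.Bool using (Bool; true; false; not)
import Data.Bool.Properties as Bool
open import Data.Fin using (Fin; zero; suc; toℕ; fromℕ<; lift; remQuot; combine)
import Data.Fin.Properties as Fin
import Data.Product.Properties as Product
open import Data.Sum using (_⊎_; inj₁; inj₂; [_,_]′)
import Data.Sum as Sum
open import Data.Unit using (⊤; tt)
open import Data.List using (List; []; _∷_; length; drop)
open import Data.List.Relation.Unary.Any using (here; there; index)
open import Data.List.Membership.Propositional using (_∈_)
import Data.List.Membership.DecPropositional as DecMembership
import Data.List.Membership.Setoid.Properties as Membership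
open import Relation.Binary.Construct.Closure.Symmetric as Sym using (SymClosure; fwd; bwd)
open import Relation.Binary.Definitions using (Symmetric)
open import Relation.Binary.PropositionalEquality using (_≡_; _≢_; refl; sym; trans; cong; cong₂; subst; subst₂; setoid)
open import Relation.Nullary using (¬_; Dec; yes; no; contradiction)
open import Relation.Nullary.Decidable using (_⊎-dec_; map′)
open import Function using (_∘_; id; case_of_)
open import Function.Definitions using (Injective)

-- The game

private
  open DecMembership (Product.≡-dec ℕ._≟_ (Product.≡-dec ℕ._≟_ Bool._≟_)) using (_∈?_)

  col? : ∀ P x y c → Dec (Col P x y c)
  col? P x y c = ((x , y , c) ∈? P) ⊎-dec ((y , x , c) ∈? P)

  adj? : ∀ P x y → Dec (Adj P x y)
  adj? P x y = map′ [ true ,_ , false ,_ ]′ (λ { (true , p) → inj₁ p ; (false , p) → inj₂ p })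
    (col? P x y true ⊎-dec col? P x y false)

col-sym : ∀ {P x y c} → Col P x y c → Col P y x c
col-sym = Sum.swap

_⊑_ : Position → Position → Set
P ⊑ Q = ∀ {x y c} → Col P x y c → Col Q x y c

⊑-trans : ∀ {P Q S} → P ⊑ Q → Q ⊑ S → P ⊑ S
⊑-trans p q = q ∘ p

Within : (ℕ → ℕ → Set) → Position → Set
Within K P = ∀ {x y} → Adj P x y → K x y

within-∷ : ∀ {K P x y c} → Symmetric K → K x y → Within K P → Within K ((x , y , c) ∷ P)
within-∷ s k w (c , inj₁ (here refl)) = k
within-∷ s k w (c , inj₁ (there e)) = w (c , inj₁ e)
within-∷ s k w (c , inj₂ (here refl)) = s k
within-∷ s k w (c , inj₂ (there e)) = w (c , inj₂ e)

⊑-∷ : ∀ {P e} → P ⊑ (e ∷ P)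
⊑-∷ = Sum.map there there

module Game (V : Set) (E : V → V → Set) where
  Wins : ℕ → Position → Set
  Wins = BuilderWins V E

  wins-mono : ∀ {m n P} → m ≤ n → Wins m P → Wins n P
  wins-mono m≤n (done g) = done g
  wins-mono (s≤s m≤n) (step x y ne na k) = step x y ne na (wins-mono m≤n ∘ k)

  -- If the edge is already present its colour is known and no round is spent.
  query : ∀ {K m P x y} → Symmetric K → Within K P → K x y → x ≢ y →
    (∀ {Q} c → P ⊑ Q → Within K Q → Col Q x y c → Wins m Q) → Wins (suc m) P
  query {P = P} {x} {y} K-sym w kxy x≢y k with adj? P x y
  ... | yes (c , e) = wins-mono (ℕ.n≤1+n _) (k c id w e)
  ... | no ¬e = step x y x≢y ¬e λ c →
        k c ⊑-∷ (within-∷ K-sym kxy w) (inj₁ (here refl))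

  probe : ∀ {K m P h} n (u : Fin n → ℕ) → Symmetric K → Within K P →
    (∀ a → K h (u a)) → (∀ a → h ≢ u a) →
    (∀ {Q} (χ : Fin n → Colour) → P ⊑ Q → Within K Q → (∀ a → Col Q h (u a) (χ a)) → Wins m Q) →
    Wins (n + m) P
  probe zero u K-sym w kh h≢u k = k (λ ()) id w λ ()
  probe (suc n) u K-sym w kh h≢u k =
    query K-sym w (kh zero) (h≢u zero) λ c le w′ e →
    probe n (u ∘ suc) K-sym w′ (kh ∘ suc) (h≢u ∘ suc) λ χ le′ w″ es →
    k (λ { zero → c ; (suc a) → χ a }) (⊑-trans {_} {_} {_} le le′) w″
      (λ { zero → le′ e ; (suc a) → es a })

-- The newest item of a chain is at the head of the list; Q receives the position counted from the oldest one.

module _ {A : Set} (vertex : A → ℕ) where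
  Linked : Position → Colour → ℕ → List A → Set
  Linked P c x [] = ⊤
  Linked P c x (b ∷ _) = Col P x (vertex b) c

  Chain : Position → Colour → (ℕ → A → Set) → List A → Set
  Chain P c Q [] = ⊤
  Chain P c Q (a ∷ as) = Chain P c Q as × Q (length as) a × Linked P c (vertex a) as

  linked-mono : ∀ {P P′ c x} as → P ⊑ P′ → Linked P c x as → Linked P′ c x as
  linked-mono [] le l = tt
  linked-mono (_ ∷ _) le l = le l

  chain-map : ∀ {P P′ c Q Q′} as → P ⊑ P′ → (∀ {h a} → h < length as → Q h a → Q′ h a) →
    Chain P c Q as → Chain P′ c Q′ as
  chain-map [] le f _ = tt
  chain-map (a ∷ as) le f (ch , q , l) =
    chain-map as le (f ∘ ℕ.m<n⇒m<1+n) ch , f ℕ.≤-refl q , linked-mono as le l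

  -- Reindexes from the oldest item; values beyond the length are arbitrary. The last component is
  -- what the induction uses to link the next item to the newest one.
  chain-lookup : ∀ {P c Q} as → 0 < length as → Chain P c Q as →
    Σ (ℕ → A) λ f → (∀ {s} → s < length as → Q s (f s)) ×
      (∀ {s} → suc s < length as → Col P (vertex (f s)) (vertex (f (suc s))) c) ×
      (∀ {x} → Linked P c x as → Col P x (vertex (f (pred (length as)))) c)
  chain-lookup (a ∷ []) _ (_ , q , _) = (λ _ → a) , (λ { {zero} _ → q ; {suc _} (s≤s ()) }) , (λ { (s≤s ()) }) , id
  chain-lookup {P} {c} {Q} (a ∷ as@(_ ∷ _)) _ (ch , q , l) with chain-lookup as (s≤s z≤n) ch
  ... | f , p , r , t = g , p′ , r′ , t′
    where
    g : ℕ → A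
    g s with s ℕ.≟ length as
    ... | yes _ = a
    ... | no _ = f s
    p′ : ∀ {s} → s < suc (length as) → Q s (g s)
    p′ {s} lt with s ℕ.≟ length as
    ... | yes refl = q
    ... | no ne = p (ℕ.≤∧≢⇒< (ℕ.≤-pred lt) ne)
    r′ : ∀ {s} → suc s < suc (length as) → Col P (vertex (g s)) (vertex (g (suc s))) c
    r′ {s} (s≤s lt) with s ℕ.≟ length as | suc s ℕ.≟ length as
    ... | yes refl | _ = contradiction lt (ℕ.<-irrefl refl)
    ... | no _ | yes refl = col-sym {P} (t l)
    ... | no _ | no ne = r (ℕ.≤∧≢⇒< lt ne)
    t′ : ∀ {x} → Col P x (vertex a) c → Col P x (vertex (g (length as))) c
    t′ e with length as ℕ.≟ length as
    ... | yes _ = e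
    ... | no ne = contradiction refl ne

-- Forcing a monochromatic induced path

data PathRole : Set where
  off : PathRole
  pos : ℕ → PathRole

-- An arc permits an edge without asserting one. `off` is compatible with every role, itself
-- included, and so fits vertices about which nothing is known.
data PathArc : PathRole → PathRole → Set where
  off  : ∀ {b} → PathArc off b
  next : ∀ {h} → PathArc (pos h) (pos (suc h))

-- Vertices from `bound` on are isolated, hence available as new vertices later. The roles certify
-- that the path is induced.
record LongPath (n : ℕ) (P : Position) : Set where
  field
    colour : Colour
    bound : ℕ
    role : ℕ → PathRole
    adj : ∀ {x y} → Adj P x y → x < bound × y < bound × SymClosure PathArc (role x) (role y)
    vertex : ℕ → ℕ
    vertex-role : ∀ {h} → h < n → vertex h < bound × role (vertex h) ≡ pos h
    edge : ∀ {h} → suc h < n → Col P (vertex h) (vertex (suc h)) colour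

-- A red (true) vertex with flag true has no neighbour on the blue (false) comb; with flag false it is a former
-- leaf and may have one. leaf t i would become spine t. Vertices dropped from the stack or the comb may keep
-- their role, because a role only bounds the adjacencies of a vertex from above.
data SearchRole : Set where
  dead  : SearchRole
  red   : ℕ → Bool → SearchRole
  spine : ℕ → SearchRole
  leaf  : ℕ → ℕ → SearchRole

-- What is absent matters: no `red h true` meets the spine and no red role meets a leaf. This lets a
-- leaf join either side, and a clean red vertex join the spine once its red neighbours are given
-- up.
data SearchArc : SearchRole → SearchRole → Set where
  dead  : ∀ {b} → SearchArc dead b
  red   : ∀ {h b b′} → SearchArc (red h b) (red (suc h) b′)
  link  : ∀ {h s} → SearchArc (red h false) (spine s)
  spine : ∀ {s} → SearchArc (spine s) (spine (suc s))
  leaf  : ∀ {s i} → SearchArc (spine s) (leaf (suc s) i)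

Link : SearchRole → SearchRole → Set
Link = SymClosure SearchArc

-- All four outcomes of a round have this form: `γ` revises the stack roles and `σ` is the new role
-- of the chosen leaf. Acting on roles rather than vertices reduces the check to the arcs of the
-- role graph.
relabel : (ℕ → Bool → SearchRole) → ℕ → ℕ → SearchRole → SearchRole → SearchRole
relabel γ m r σ dead = dead
relabel γ m r σ (red h b) = γ h b
relabel γ m r σ (spine s) = spine s
relabel γ m r σ (leaf t i) with t ℕ.≟ m | i ℕ.≟ r
... | yes _ | yes _ = σ
... | _ | _ = leaf t i

relabel-picked : ∀ γ m r σ → relabel γ m r σ (leaf m r) ≡ σ
relabel-picked γ m r σ with m ℕ.≟ m | r ℕ.≟ r
... | yes _ | yes _ = refl
... | no ne | _ = contradiction refl ne
... | yes _ | no ne = contradiction refl ne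

relabel-other : ∀ γ m r σ {t i} → (t ≡ m → i < r) → relabel γ m r σ (leaf t i) ≡ leaf t i
relabel-other γ m r σ {t} {i} lt with t ℕ.≟ m | i ℕ.≟ r
... | yes e | yes refl = contradiction (lt e) (ℕ.<-irrefl refl)
... | yes _ | no _ = refl
... | no _ | _ = refl

relabel-link : ∀ {γ m r σ} → (∀ h b b′ → Link (γ h b) (γ (suc h) b′)) →
  (∀ h s → Link (γ h false) (spine s)) → (∀ s → suc s ≡ m → Link (spine s) σ) →
  ∀ {a b} → Link a b → Link (relabel γ m r σ a) (relabel γ m r σ b)
relabel-link {γ} {m} {r} {σ} γ-red γ-link σ-spine =
  Sym.gfold {S = Link} (Sym.symmetric SearchArc) (relabel γ m r σ) arc
  where
  arc : ∀ {a b} → SearchArc a b → Link (relabel γ m r σ a) (relabel γ m r σ b)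
  arc dead = fwd dead
  arc red = γ-red _ _ _
  arc link = γ-link _ _
  arc spine = fwd spine
  arc (leaf {s} {i}) with suc s ℕ.≟ m | i ℕ.≟ r
  ... | yes e | yes _ = σ-spine s e
  ... | yes _ | no _ = fwd leaf
  ... | no _ | _ = fwd leaf

cut : ℕ → ℕ → Bool → SearchRole
cut h h′ b with h′ <? h
... | yes _ = red h′ b
... | no _ = dead

cut-below : ∀ {h h′ b} → h′ < h → cut h h′ b ≡ red h′ b
cut-below {h} {h′} lt with h′ <? h
... | yes _ = refl
... | no ¬lt = contradiction lt ¬lt

cut-above : ∀ {h h′ b} → h ≤ h′ → cut h h′ b ≡ dead
cut-above {h} {h′} le with h′ <? h
... | yes lt = contradiction (ℕ.<-≤-trans lt le) (ℕ.<-irrefl refl)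
... | no _ = refl

cut-red : ∀ h h′ b b′ → Link (cut h h′ b) (cut h (suc h′) b′)
cut-red h h′ b b′ with h′ <? h | suc h′ <? h
... | yes _ | yes _ = fwd red
... | yes _ | no _ = bwd dead
... | no _ | _ = fwd dead

cut-link : ∀ h h′ s → Link (cut h h′ false) (spine s)
cut-link h h′ s with h′ <? h
... | yes _ = fwd link
... | no _ = fwd dead

-- Moves the clean red vertex at height h to the spine and discards its neighbours on the stack.
promote : ℕ → ℕ → ℕ → Bool → SearchRole
promote h s h′ false = cut (pred h) h′ false
promote h s h′ true with h′ ℕ.≟ h
... | yes _ = spine s
... | no _ = cut (pred h) h′ true

promote-below : ∀ {h s h′} b → h′ < pred h → promote h s h′ b ≡ red h′ b
promote-below false lt = cut-below lt
promote-below {h} {s} {h′} true lt with h′ ℕ.≟ h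
... | yes refl = contradiction (ℕ.<-≤-trans lt (ℕ.pred[n]≤n)) (ℕ.<-irrefl refl)
... | no _ = cut-below lt

promote-at : ∀ {h s} → promote h s h true ≡ spine s
promote-at {h} with h ℕ.≟ h
... | yes _ = refl
... | no ne = contradiction refl ne

-- If one end is promoted, the other has height `h - 1` or `h + 1`; both are at least `pred h`, so
-- that end is cut to `dead`, which may meet the spine.
promote-red : ∀ h s h′ b b′ → Link (promote h s h′ b) (promote h s (suc h′) b′)
promote-red h s h′ false false = cut-red _ h′ _ _
promote-red h s h′ true false with h′ ℕ.≟ h
... | yes refl = subst (Link _) (sym (cut-above (ℕ.≤-trans ℕ.pred[n]≤n (ℕ.n≤1+n h)))) (bwd dead)
... | no _ = cut-red _ h′ _ _
promote-red h s h′ false true with suc h′ ℕ.≟ h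
... | yes refl = subst (λ a → Link a _) (sym (cut-above ℕ.≤-refl)) (fwd dead)
... | no _ = cut-red _ h′ _ _
promote-red h s h′ true true with h′ ℕ.≟ h | suc h′ ℕ.≟ h
... | yes refl | yes e = contradiction e ℕ.1+n≢n
... | yes refl | no _ = subst (Link _) (sym (cut-above (ℕ.≤-trans ℕ.pred[n]≤n (ℕ.n≤1+n h)))) (bwd dead)
... | no _ | yes refl = subst (λ a → Link a _) (sym (cut-above ℕ.≤-refl)) (fwd dead)
... | no _ | no _ = cut-red _ h′ _ _

extend : ℕ → (SearchRole → SearchRole) → (ℕ → SearchRole) → (ℕ → SearchRole) → ℕ → SearchRole
extend N G role φ x with x <? N
... | yes _ = G (role x)
... | no _ = φ (x ∸ N)

extend-old : ∀ {N} G role φ {x} → x < N → extend N G role φ x ≡ G (role x)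
extend-old {N} G role φ {x} lt with x <? N
... | yes _ = refl
... | no ¬lt = contradiction lt ¬lt

extend-new : ∀ N G role φ i → extend N G role φ (N + i) ≡ φ i
extend-new N G role φ i with (N + i) <? N
... | yes lt = contradiction lt (ℕ.m+n≮m N i)
... | no _ = cong φ (ℕ.m+n∸m≡n N i)

Item : Set
Item = Bool × ℕ

Level : Set
Level = ℕ × ℕ × ℕ

RedAt : ℕ → (ℕ → SearchRole) → ℕ → Item → Set
RedAt N role h (b , x) = x < N × role x ≡ red h b

LevelAt : ℕ → (ℕ → SearchRole) → Position → ℕ → Level → Set
LevelAt N role P s (p , base , r) = p < N × role p ≡ spine s × r ≤ 6 ×
  (∀ {i} → i < r → base + i < N × role (base + i) ≡ leaf (suc s) i × Col P p (base + i) false)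

Hom : ℕ → (ℕ → SearchRole) → Position → Set
Hom N role P = ∀ {x y} → Adj P x y → x < N × y < N × Link (role x) (role y)

Stack : ℕ → (ℕ → SearchRole) → Position → List Item → Set
Stack N role P = Chain proj₂ P true (RedAt N role)

Comb : ℕ → (ℕ → SearchRole) → Position → List Level → Set
Comb N role P = Chain proj₁ P false (LevelAt N role P)

record Inv (N : ℕ) (role : ℕ → SearchRole) (P : Position) (R : List Item) (B : List Level) : Set where
  constructor inv
  field
    hom : Hom N role P
    stack : Stack N role P R
    comb : Comb N role P B

topCount : List Level → ℕ
topCount [] = 0
topCount ((_ , _ , r) ∷ _) = r

module _ {N N′ : ℕ} {role role′ : ℕ → SearchRole} {P P′ : Position} (G : SearchRole → SearchRole) (N≤N′ : N ≤ N′) (P⊑P′ : P ⊑ P′)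
  (old : ∀ {x} → x < N → role′ x ≡ G (role x)) where

  moved : ∀ {x a b} → x < N → role x ≡ a → G a ≡ b → x < N′ × role′ x ≡ b
  moved lt e e′ = ℕ.<-≤-trans lt N≤N′ , trans (old lt) (trans (cong G e) e′)

  stack-map : ∀ R → (∀ {h b} → h < length R → G (red h b) ≡ red h b) →
    Stack N role P R → Stack N′ role′ P′ R
  stack-map R G-red = chain-map proj₂ R P⊑P′ λ { h< (lt , e) → moved lt e (G-red h<) }

  -- In use, `r` is the index of the chosen leaf. Lower levels have smaller `t`, and the top level
  -- keeps only indices below `r`, so `G` may move that leaf freely.
  comb-map : ∀ {r} B → topCount B ≤ r → (∀ {s} → G (spine s) ≡ spine s) →
    (∀ {t i} → (t ≡ length B → i < r) → G (leaf t i) ≡ leaf t i) →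
    Comb N role P B → Comb N′ role′ P′ B
  comb-map [] _ _ _ _ = tt
  comb-map {r} ((p , base , r′) ∷ B) r′≤r G-spine G-leaf (ch , lv , l) =
    chain-map proj₁ B P⊑P′ (λ h< → level (λ e → contradiction h< (ℕ.<-irrefl (ℕ.suc-injective e)))) ch ,
    level (λ _ i< → ℕ.<-≤-trans i< r′≤r) lv , linked-mono proj₁ B P⊑P′ l
    where
    level : ∀ {s p base r′} → (suc s ≡ suc (length B) → ∀ {i} → i < r′ → i < r) →
      LevelAt N role P s (p , base , r′) → LevelAt N′ role′ P′ s (p , base , r′)
    level f (lt , e , r≤6 , ls) = let lt′ , e′ = moved lt e G-spine in
      lt′ , e′ , r≤6 , λ i< → let bl , be , bc = ls i< ; bl′ , be′ = moved bl be (G-leaf λ q → f q i<)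
                              in bl′ , be′ , P⊑P′ bc

module _ {N : ℕ} (role : ℕ → SearchRole) (φ : ℕ → SearchRole) where
  private
   role′ : ℕ → SearchRole
   role′ = extend N id role φ

  -- Vertex `N` has no edges yet, and roles restrict only edges, so any role suits it.
  grow : ∀ {P R B} → Inv N role P R B → Inv (suc N) role′ P R B
  grow {P} {R} {B} (inv hom st cb) = inv
    (λ a → let x< , y< , l = hom a in
      ℕ.m<n⇒m<1+n x< , ℕ.m<n⇒m<1+n y< ,
      subst₂ Link (sym (extend-old id role φ x<)) (sym (extend-old id role φ y<)) l)
    (stack-map id (ℕ.n≤1+n N) (λ {x} {y} {c} → id) (extend-old id role φ) R (λ _ → refl) st)
    (comb-map id (ℕ.n≤1+n N) (λ {x} {y} {c} → id) (extend-old id role φ) B ℕ.≤-refl refl (λ _ → refl) cb)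

  fresh : N < suc N × role′ N ≡ φ 0
  fresh = ℕ.≤-refl , subst (λ x → role′ x ≡ φ 0) (ℕ.+-identityʳ N) (extend-new N id role φ 0)

-- The potential and the endpoints of the next edge

cleans : List Item → ℕ
cleans [] = 0
cleans ((true , _) ∷ R) = suc (cleans R)
cleans ((false , _) ∷ R) = cleans R

leaves : List Level → ℕ
leaves [] = 0
leaves ((_ , _ , r) ∷ B) = r + leaves B

-- The top must be clean because it may have to move to the spine. Discarding `false` items does not
-- change `cleans`, and an empty stack restarts from a new vertex at no cost in rounds.
pickTop : ∀ {N role P R B} → Inv N role P R B →
  ∃ λ N′ → ∃ λ role′ → ∃ λ u → ∃ λ R₀ →
    Inv N′ role′ P ((true , u) ∷ R₀) B × cleans R ≤ suc (cleans R₀)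
pickTop {N} {role} {R = []} I = let inv hom _ cb = grow role (λ _ → red 0 true) I in
  suc N , _ , N , [] , inv hom (tt , fresh role (λ _ → red 0 true) , tt) cb , z≤n
pickTop {N} {role} {R = (true , u) ∷ R₀} I = N , role , u , R₀ , I , ℕ.≤-refl
pickTop {R = (false , _) ∷ R} (inv hom (st , _) cb) = pickTop (inv hom st cb)

record Pick (N : ℕ) (role : ℕ → SearchRole) (P : Position) (d : ℕ) (B : List Level) (r : ℕ) : Set where
  constructor pick
  field
    d< : d < N
    d-role : role d ≡ leaf (length B) r
    top≤ : topCount B ≤ r
    linked : Linked proj₁ P false d B

-- Exhausted spine vertices are dropped without changing `leaves`. For an empty comb a new vertex
-- acts as a leaf of level 0.
pickLeaf : ∀ {N role P R B} → Inv N role P R B →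
  ∃ λ N′ → ∃ λ role′ → ∃ λ d → ∃ λ B₀ → ∃ λ r →
    Inv N′ role′ P R B₀ × Pick N′ role′ P d B₀ r × leaves B ≤ suc (leaves B₀)
pickLeaf {N} {role} {B = []} I = let I′ = grow role (λ _ → leaf 0 0) I ; lt , e = fresh role (λ _ → leaf 0 0) in
  suc N , _ , N , [] , 0 , I′ , pick lt e z≤n tt , z≤n
pickLeaf {P = P} {B = (p , base , zero) ∷ B} (inv hom st (cb , _)) = pickLeaf (inv hom st cb)
pickLeaf {N} {role} {P} {B = (p , base , suc r) ∷ B} (inv hom st (cb , (p< , e , r≤ , ls) , l)) =
  let d< , de , dc = ls ℕ.≤-refl in
  N , role , base + r , (p , base , r) ∷ B , r ,
  inv hom st (cb , (p< , e , ℕ.≤-trans (ℕ.n≤1+n r) r≤ , λ i< → ls (ℕ.m<n⇒m<1+n i<)) , l) ,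
  pick d< de ℕ.≤-refl (col-sym {P} dc) , ℕ.≤-refl

-- One round of the search

Plus : (ℕ → ℕ → Set) → (ℕ → ℕ → Set) → ℕ → ℕ → Set
Plus K S x y = K x y ⊎ SymClosure S x y

plus-sym : ∀ {K S} → Symmetric K → Symmetric (Plus K S)
plus-sym K-sym = Sum.map K-sym (Sym.symmetric _)

adj-sym : ∀ {P} → Symmetric (Adj P)
adj-sym (c , e) = c , Sum.swap e

Edge : ℕ → ℕ → ℕ → ℕ → Set
Edge u d x y = x ≡ u × y ≡ d

Spoke : ℕ → ℕ → ℕ → ℕ → Set
Spoke ω N x y = x ≡ ω × Σ (Fin 6) λ a → y ≡ N + toℕ a

Grown : Position → ℕ → ℕ → ℕ → ℕ → ℕ → ℕ → Set
Grown P u d ω N = Plus (Plus (Adj P) (Edge u d)) (Spoke ω N)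

update : ∀ {N role P Q u d ω φ} (G : SearchRole → SearchRole) → Hom N role P →
  (∀ {a b} → Link a b → Link (G a) (G b)) → u < N → d < N → ω < N →
  Link (G (role u)) (G (role d)) → (∀ i → Link (G (role ω)) (φ i)) →
  Within (Grown P u d ω N) Q → Hom (N + 6) (extend N G role φ) Q
update {N} {role} {P} {Q} {u} {d} {ω} {φ} G hom G-link u< d< ω< ud ωφ w a =
  case w a of λ
    { (inj₁ (inj₁ e)) → let x< , y< , l = hom e in olds x< y< (G-link l)
    ; (inj₁ (inj₂ (fwd (refl , refl)))) → olds u< d< ud
    ; (inj₁ (inj₂ (bwd (refl , refl)))) → olds d< u< (Sym.symmetric SearchArc ud)
    ; (inj₂ (fwd (refl , i , refl))) → spoke i
    ; (inj₂ (bwd (refl , i , refl))) → let x< , y< , l = spoke i in y< , x< , Sym.symmetric SearchArc l }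
  where
  up : ∀ {x} → x < N → x < N + 6
  up lt = ℕ.<-≤-trans lt (ℕ.m≤m+n N 6)
  olds : ∀ {x y} → x < N → y < N → Link (G (role x)) (G (role y)) →
    x < N + 6 × y < N + 6 × Link (extend N G role φ x) (extend N G role φ y)
  olds x< y< l = up x< , up y< ,
    subst₂ Link (sym (extend-old G role φ x<)) (sym (extend-old G role φ y<)) l
  spoke : ∀ (i : Fin 6) → ω < N + 6 × N + toℕ i < N + 6 ×
    Link (extend N G role φ ω) (extend N G role φ (N + toℕ i))
  spoke i = up ω< , ℕ.+-monoʳ-< N (Fin.toℕ<n i) ,
    subst₂ Link (sym (extend-old G role φ ω<)) (sym (extend-new N G role φ (toℕ i))) (ωφ (toℕ i))

module _ {N : ℕ} {role : ℕ → SearchRole} {P Q : Position} (P⊑Q : P ⊑ Q) (G : SearchRole → SearchRole) (φ : ℕ → SearchRole) where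
  private
   role′ : ℕ → SearchRole
   role′ = extend N G role φ

   N≤ : N ≤ N + 6
   N≤ = ℕ.m≤m+n N 6

  moved′ : ∀ {x a b} → x < N → role x ≡ a → G a ≡ b → x < N + 6 × role′ x ≡ b
  moved′ = moved {P = P} G N≤ P⊑Q (extend-old G role φ)

  stack′ : ∀ R → (∀ {h b} → h < length R → G (red h b) ≡ red h b) →
    Stack N role P R → Stack (N + 6) role′ Q R
  stack′ = stack-map G N≤ P⊑Q (extend-old G role φ)

  comb′ : ∀ {r} B → topCount B ≤ r → (∀ {s} → G (spine s) ≡ spine s) →
    (∀ {t i} → (t ≡ length B → i < r) → G (leaf t i) ≡ leaf t i) →
    Comb N role P B → Comb (N + 6) role′ Q B
  comb′ = comb-map G N≤ P⊑Q (extend-old G role φ)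

  red-fresh : ∀ {b h} (a : Fin 6) → (∀ i → φ i ≡ red h b) → RedAt (N + 6) role′ h (b , N + toℕ a)
  red-fresh a e = ℕ.+-monoʳ-< N (Fin.toℕ<n a) , trans (extend-new N G role φ (toℕ a)) (e (toℕ a))

  fresh-level : ∀ {p s} → p < N + 6 → role′ p ≡ spine s → (∀ i → φ i ≡ leaf (suc s) i) →
    (∀ (a : Fin 6) → Col Q p (N + toℕ a) false) → LevelAt (N + 6) role′ Q s (p , N , 6)
  fresh-level {p} p< e φ-leaf cs = p< , e , ℕ.≤-refl , λ {i} i< →
    ℕ.+-monoʳ-< N i< , trans (extend-new N G role φ i) (φ-leaf i) ,
    subst (λ j → Col Q p (N + j) false) (Fin.toℕ-fromℕ< i<) (cs (fromℕ< i<))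

module _ {N role P u d R B r} (I : Inv N role P ((true , u) ∷ R) B) (pk : Pick N role P d B r) where
  open Inv I
  open Pick pk
  private
    h m : ℕ
    h = length R
    m = length B
    u< : u < N
    u< = proj₁ (proj₁ (proj₂ stack))
    u-role : role u ≡ red h true
    u-role = proj₂ (proj₁ (proj₂ stack))

    G : (ℕ → Bool → SearchRole) → SearchRole → SearchRole → SearchRole
    G γ σ = relabel γ m r σ

    Gu : ∀ γ σ {a} → γ h true ≡ a → G γ σ (role u) ≡ a
    Gu γ σ e rewrite u-role = e
    Gd : ∀ γ σ → G γ σ (role d) ≡ σ
    Gd γ σ rewrite d-role = relabel-picked γ m r σ

  u≢d : u ≢ d
  u≢d refl = case trans (sym u-role) d-role of λ ()

  private
    step-hom : ∀ {Q ω φ γ σ α ω′} → (∀ h b b′ → Link (γ h b) (γ (suc h) b′)) →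
      (∀ h s → Link (γ h false) (spine s)) → (∀ s → suc s ≡ m → Link (spine s) σ) →
      ω < N → γ h true ≡ α → Link α σ → G γ σ (role ω) ≡ ω′ → (∀ i → Link ω′ (φ i)) →
      Within (Grown P u d ω N) Q → Hom (N + 6) (extend N (G γ σ) role φ) Q
    step-hom {γ = γ} {σ} γ-red γ-link σ-spine ω< γh uσ eω ωφ =
      update (G γ σ) hom (relabel-link {γ} γ-red γ-link σ-spine) u< d< ω<
        (subst₂ Link (sym (Gu γ σ γh)) (sym (Gd γ σ)) uσ)
        (λ i → subst (λ x → Link x _) (sym eω) (ωφ i))

    top-linked : ∀ {Q} → P ⊑ Q → Linked proj₁ Q false d B
    top-linked le = linked-mono proj₁ B le linked

  -- blue ud, some red spoke at u
  after-α : ∀ {Q} (a : Fin 6) → P ⊑ Q → Within (Grown P u d u N) Q → Col Q u (N + toℕ a) true →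
    ∃ λ role′ → Inv (N + 6) role′ Q ((true , N + toℕ a) ∷ (true , u) ∷ R) B
  after-α {Q} a le w c = _ , inv
    (step-hom (λ _ _ _ → fwd red) (λ _ _ → fwd link) (λ _ _ → bwd dead) u< refl (bwd dead) (Gu red dead refl) (λ _ → fwd red) w)
    (stack′ le (G red dead) φ _ (λ _ → refl) stack ,
      red-fresh {P = P} le (G red dead) φ a (λ _ → refl) , col-sym {Q} c)
    (comb′ le (G red dead) φ B top≤ refl (relabel-other red m r dead) comb)
    where
    φ : ℕ → SearchRole
    -- All six new vertices are adjacent to `u` alone, so they may share the next stack role
    -- although only one is pushed.
    φ _ = red (suc h) true

  -- red ud, some red spoke at d
  after-γ : ∀ {Q} (a : Fin 6) → P ⊑ Q → Within (Grown P u d d N) Q → Col Q u d true → Col Q d (N + toℕ a) true →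
    ∃ λ role′ → Inv (N + 6) role′ Q ((true , N + toℕ a) ∷ (false , d) ∷ (true , u) ∷ R) B
  after-γ {Q} a le w ud c = _ , inv
    (step-hom (λ _ _ _ → fwd red) (λ _ _ → fwd link) (λ _ _ → bwd link) d< refl (fwd red) (Gd red _) (λ _ → fwd red) w)
    ((stack′ le g φ _ (λ _ → refl) stack , moved′ le g φ d< d-role (relabel-picked red m r _) , col-sym {Q} ud) ,
      red-fresh {P = P} le g φ a (λ _ → refl) , col-sym {Q} c)
    (comb′ le g φ B top≤ refl (relabel-other red m r _) comb)
    where
    g : SearchRole → SearchRole
    -- The flag is `false` because `d` keeps any blue edge to the end of the spine.
    g = G red (red (suc h) false)
    φ : ℕ → SearchRole
    φ _ = red (suc (suc h)) true

  spine-next : ∀ s → suc s ≡ m → Link (spine s) (spine m)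
  spine-next s e = subst (λ t → Link (spine s) (spine t)) e (fwd spine)

  -- red ud, all spokes at d blue
  after-δ : ∀ {Q} → P ⊑ Q → Within (Grown P u d d N) Q → (∀ (a : Fin 6) → Col Q d (N + toℕ a) false) →
    ∃ λ role′ → Inv (N + 6) role′ Q R ((d , N , 6) ∷ B)
  after-δ {Q} le w cs = _ , inv
    -- `u` is adjacent to `d`, which is now on the spine, so height `h` becomes `dead`.
    (step-hom (cut-red h) (cut-link h) spine-next d< (cut-above {h} {h} {true} ℕ.≤-refl) (fwd dead) (Gd (cut h) _) (λ _ → fwd leaf) w)
    (stack′ le g φ R cut-below (proj₁ stack))
    (comb′ le g φ B top≤ refl (relabel-other (cut h) m r _) comb ,
      (let d<′ , de = moved′ le g φ d< d-role (relabel-picked (cut h) m r _) in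
       fresh-level le g φ d<′ de (λ _ → refl) cs) , top-linked le)
    where
    g : SearchRole → SearchRole
    g = G (cut h) (spine m)
    φ : ℕ → SearchRole
    φ = leaf (suc m)

  -- blue ud, all spokes at u blue
  after-β : ∀ {Q} → P ⊑ Q → Within (Grown P u d u N) Q → Col Q u d false → (∀ (a : Fin 6) → Col Q u (N + toℕ a) false) →
    ∃ λ role′ → Inv (N + 6) role′ Q (drop 1 R) ((u , N , 6) ∷ (d , N , 0) ∷ B)
  after-β {Q} le w ud cs = _ , inv
    (step-hom (promote-red h (suc m)) (λ h′ s → cut-link (pred h) h′ s) spine-next u< (promote-at {h}) (bwd spine)
      (Gu γ _ (promote-at {h})) (λ _ → fwd leaf) w)
    (stack′ le g φ (drop 1 R) (λ {h′} {b} lt → promote-below b (subst (h′ <_) (length-tail R) lt)) (tail-stack R (proj₁ stack)))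
    ((comb′ le g φ B top≤ refl (relabel-other γ m r _) comb ,
      -- `d` received no spokes: it joins the spine with 0 leaves and the dummy base `N`.
      (let d<′ , de = moved′ le g φ d< d-role (relabel-picked γ m r _) in d<′ , de , z≤n , λ ()) , top-linked le) ,
      (let u<′ , ue = moved′ le g φ u< u-role (promote-at {h}) in fresh-level le g φ u<′ ue (λ _ → refl) cs) , ud)
    where
    γ : ℕ → Bool → SearchRole
    γ = promote h (suc m)
    g : SearchRole → SearchRole
    g = G γ (spine m)
    φ : ℕ → SearchRole
    φ = leaf (suc (suc m))
    length-tail : ∀ (R : List Item) → length (drop 1 R) ≡ pred (length R)
    length-tail [] = refl
    length-tail (_ ∷ _) = refl
    tail-stack : ∀ R → Stack N role P R → Stack N role P (drop 1 R)
    tail-stack [] _ = tt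
    tail-stack (_ ∷ _) (st , _) = st

cleans≤length : ∀ R → cleans R ≤ length R
cleans≤length [] = z≤n
cleans≤length ((true , _) ∷ R) = s≤s (cleans≤length R)
cleans≤length ((false , _) ∷ R) = ℕ.m≤n⇒m≤1+n (cleans≤length R)

leaves≤ : ∀ {N role P} B → Comb N role P B → leaves B ≤ length B * 6
leaves≤ [] _ = z≤n
leaves≤ ((_ , _ , r) ∷ B) (cb , (_ , _ , r≤6 , _) , _) = ℕ.+-mono-≤ r≤6 (leaves≤ B cb)

cleans-tail : ∀ R → cleans R ≤ suc (cleans (drop 1 R))
cleans-tail [] = z≤n
cleans-tail ((true , _) ∷ R) = ℕ.≤-refl
cleans-tail ((false , _) ∷ R) = ℕ.n≤1+n _

-- Reading a path off the search

redRole : SearchRole → PathRole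
redRole (red h _) = pos h
redRole _ = off

redRole-arc : ∀ {a b} → SearchArc a b → SymClosure PathArc (redRole a) (redRole b)
redRole-arc dead = fwd off
redRole-arc red = fwd next
redRole-arc link = bwd off
redRole-arc spine = fwd off
redRole-arc leaf = fwd off

spineRole : SearchRole → PathRole
spineRole (spine s) = pos s
spineRole _ = off

spineRole-arc : ∀ {a b} → SearchArc a b → SymClosure PathArc (spineRole a) (spineRole b)
spineRole-arc dead = fwd off
spineRole-arc red = fwd off
spineRole-arc link = fwd off
spineRole-arc spine = fwd next
spineRole-arc leaf = bwd off

-- `g` collapses every role foreign to the chain to `off`. It preserves arcs, so the chain is an
-- induced path of the whole graph.
chain-path : ∀ {A : Set} (vertex : A → ℕ) {n N role P c} {Q : ℕ → A → Set} (g : SearchRole → PathRole) →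
  (∀ {a b} → SearchArc a b → SymClosure PathArc (g a) (g b)) → Hom N role P →
  (∀ {h a} → Q h a → vertex a < N × g (role (vertex a)) ≡ pos h) →
  ∀ as → Chain vertex P c Q as → 0 < n → n ≤ length as → LongPath n P
chain-path vertex {n} {N} {role} {P} {c} g g-arc hom f as ch 0<n n≤ with chain-lookup vertex as (ℕ.<-≤-trans 0<n n≤) ch
... | v , q , e , _ = record
  { colour = c ; bound = N ; role = g ∘ role
  ; adj = λ a → let x< , y< , l = hom a in
      x< , y< , Sym.gfold {S = SymClosure PathArc} (Sym.symmetric _) g g-arc l
  ; vertex = vertex ∘ v
  ; vertex-role = λ h< → f (q (ℕ.<-≤-trans h< n≤))
  ; edge = λ h< → e (ℕ.<-≤-trans h< n≤) }

module _ {V : Set} {E : V → V → Set} where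
  open Game V E

  module ForcePath (n m : ℕ) (0<n : 0 < n) (k : ∀ {P} → LongPath n P → Wins m P) where

    finish : ∀ {N role P R B} → Inv N role P R B → 8 * n ≤ 2 * cleans R + leaves B → Wins m P
    finish {N} {role} {P} {R} {B} (inv hom st cb) le with n ≤? cleans R
    ... | yes n≤ = k (chain-path proj₂ redRole redRole-arc hom
          (λ { (x< , e) → x< , cong redRole e }) R st 0<n (ℕ.≤-trans n≤ (cleans≤length R)))
    ... | no n≰ = k (chain-path proj₁ spineRole spineRole-arc hom
          (λ { (x< , e , _) → x< , cong spineRole e }) B cb 0<n n≤B)
      where
      open ℕ.≤-Reasoning
      n≤B : n ≤ length B
      n≤B = ℕ.*-cancelʳ-≤ n (length B) 6 (ℕ.+-cancelˡ-≤ (2 * n) _ _ (begin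
        2 * n + n * 6 ≡⟨ solve₁ n ⟩
        8 * n ≤⟨ le ⟩
        2 * cleans R + leaves B ≤⟨ ℕ.+-mono-≤ (ℕ.*-monoʳ-≤ 2 (ℕ.<⇒≤ (ℕ.≰⇒> n≰))) (leaves≤ B cb) ⟩
        2 * n + length B * 6 ∎))
        where
        solve₁ : ∀ n → 2 * n + n * 6 ≡ 8 * n
        solve₁ = solve-∀

    -- The potential 2 · cleans R + leaves B grows by at least one every seven rounds.
    rise : ∀ {c l f} c₀ l₀ c′ l′ → c ≤ suc c₀ → l ≤ suc l₀ →
      2 * c₀ + (4 + l₀) ≤ 2 * c′ + l′ →
      8 * n ≤ 2 * c + l + suc f → 8 * n ≤ 2 * c′ + l′ + f
    rise {c} {l} {f} c₀ l₀ c′ l′ c≤ l≤ gain le = begin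
      8 * n ≤⟨ le ⟩
      2 * c + l + suc f ≤⟨ ℕ.+-monoˡ-≤ (suc f) (ℕ.+-mono-≤ (ℕ.*-monoʳ-≤ 2 c≤) l≤) ⟩
      2 * suc c₀ + suc l₀ + suc f ≡⟨ solve₂ c₀ l₀ f ⟩
      2 * c₀ + (4 + l₀) + f ≤⟨ ℕ.+-monoˡ-≤ f gain ⟩
      2 * c′ + l′ + f ∎
      where
      open ℕ.≤-Reasoning
      solve₂ : ∀ c l f → 2 * suc c + suc l + suc f ≡ 2 * c + (4 + l) + f
      solve₂ = solve-∀

    -- A red spoke: `u` stays and one more clean vertex arrives. The 4 is two units for taking `u`,
    -- one for the leaf `d` and one of profit.
    push-gain : ∀ c l → 2 * c + (4 + l) ≡ 2 * suc (suc c) + l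
    push-gain = solve-∀

    -- Why there are six spokes: when `u` joins the spine, up to two clean vertices leave the stack,
    -- and five new leaves would give no profit.
    pop-gain : ∀ c l → 2 * suc c + (4 + l) ≡ 2 * c + (6 + l)
    pop-gain = solve-∀

    -- `f` bounds how far the potential is below `8n`; each unit pays for the edge `ud` and six
    -- spokes.
    run : ∀ f {N role P R B} → Inv N role P R B → 8 * n ≤ 2 * cleans R + leaves B + f → Wins (f * 7 + m) P
    run zero I le = finish I (subst (8 * n ≤_) (ℕ.+-identityʳ _) le)
    run (suc f) {P = P} I₀ le with pickTop I₀
    ... | _ , _ , u , R , I₁ , c≤ with pickLeaf I₁
    ... | N , role , d , B , r , I , pk , l≤ =
      query adj-u (λ a → inj₁ a) (inj₂ (fwd (refl , refl))) (u≢d I pk) λ where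
        true le₁ w₁ ud → star d (Pick.d< pk) w₁ λ where
          le₂ w₂ (inj₁ (a , c)) → let _ , I′ = after-γ I pk a (⊑-trans {P} le₁ le₂) w₂ (le₂ ud) c in
            run f I′ (rise (cleans R) (leaves B) (suc (suc (cleans R))) (leaves B) c≤ l≤ (ℕ.≤-reflexive (push-gain (cleans R) (leaves B))) le)
          le₂ w₂ (inj₂ cs) → let _ , I′ = after-δ I pk (⊑-trans {P} le₁ le₂) w₂ cs in
            run f I′ (rise (cleans R) (leaves B) (cleans R) (6 + leaves B) c≤ l≤ (ℕ.+-monoʳ-≤ (2 * cleans R) (ℕ.+-monoˡ-≤ (leaves B) (ℕ.m≤m+n 4 2))) le)
        false le₁ w₁ ud → star u (proj₁ (proj₁ (proj₂ (Inv.stack I)))) w₁ λ where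
          le₂ w₂ (inj₁ (a , c)) → let _ , I′ = after-α I pk a (⊑-trans {P} le₁ le₂) w₂ c in
            run f I′ (rise (cleans R) (leaves B) (suc (suc (cleans R))) (leaves B) c≤ l≤ (ℕ.≤-reflexive (push-gain (cleans R) (leaves B))) le)
          le₂ w₂ (inj₂ cs) → let _ , I′ = after-β I pk (⊑-trans {P} le₁ le₂) w₂ (le₂ ud) cs in
            run f I′ (rise (cleans R) (leaves B) (cleans (drop 1 R)) (6 + leaves B) c≤ l≤ (ℕ.≤-trans
              (ℕ.+-monoˡ-≤ (4 + leaves B) (ℕ.*-monoʳ-≤ 2 (cleans-tail R)))
              (ℕ.≤-reflexive (pop-gain (cleans (drop 1 R)) (leaves B)))) le)
      where
      adj-u : Symmetric (Plus (Adj P) (Edge u d))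
      adj-u = plus-sym {Adj P} (adj-sym {P})
      star : ∀ {Q m} ω → ω < N → Within (Plus (Adj P) (Edge u d)) Q →
        (∀ {S} → Q ⊑ S → Within (Grown P u d ω N) S →
          (Σ (Fin 6) λ a → Col S ω (N + toℕ a) true) ⊎ (∀ (a : Fin 6) → Col S ω (N + toℕ a) false) → Wins m S) →
        Wins (6 + m) Q
      star ω ω< w k′ = probe 6 (λ a → N + toℕ a) (plus-sym {Plus (Adj P) (Edge u d)} adj-u) (λ a → inj₁ (w a))
        (λ a → inj₂ (fwd (refl , a , refl)))
        (λ a e → ℕ.<-irrefl e (ℕ.<-≤-trans ω< (ℕ.m≤m+n N _)))
        λ χ le w′ es → k′ le w′ (case Fin.any? (λ a → χ a Bool.≟ true) of λ where
          (yes (a , e)) → inj₁ (a , subst (Col _ ω _) e (es a))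
          (no ¬e) → inj₂ λ a → subst (Col _ ω _) (Bool.¬-not λ e → ¬e (a , e)) (es a))

    forcePath : Wins (8 * n * 7 + m) []
    forcePath = run (8 * n) {0} {λ _ → dead} {R = []} {B = []}
      (inv (λ { (_ , inj₁ ()) ; (_ , inj₂ ()) }) tt tt) ℕ.≤-refl

-- From a path to a spider

module _ {R : Set} (Arc : R → R → Set) (role : ℕ → R) where
  Respects : Position → Set
  Respects = Within λ x y → SymClosure Arc (role x) (role y)

module _ {R : Set} {Arc : R → R → Set} {role : ℕ → R} {k ℓ : ℕ} {P : Position} {c : Colour}
  {w : ℕ} {η : R} {leg′ : Fin k → ℕ → ℕ} {λ′ : Fin k → ℕ → R} where
  -- Distinct roles force distinct vertices and unlinked roles exclude edges, so only the colours of
  -- the spider's own edges are asked of the position.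
  spiderCopy : Respects Arc role P →
    role w ≡ η → (∀ i {s} → s < ℓ → role (leg′ i s) ≡ λ′ i s) →
    (∀ {i s} → η ≢ λ′ i s) → (∀ {i j s t} → λ′ i s ≡ λ′ j t → i ≡ j × s ≡ t) →
    (∀ i → 0 < ℓ → Col P w (leg′ i 0) c) →
    (∀ i {s} → suc s < ℓ → Col P (leg′ i s) (leg′ i (suc s)) c) →
    ¬ SymClosure Arc η η → (∀ {i s} → SymClosure Arc η (λ′ i s) → s ≡ 0) →
    (∀ {i j s t} → SymClosure Arc (λ′ i s) (λ′ j t) → i ≡ j × (suc s ≡ t ⊎ suc t ≡ s)) →
    MonoInducedCopy (SpiderV k ℓ) (SpiderAdj k ℓ) P
  spiderCopy resp w-role leg-role η≢λ λ-inj root-col leg-col ηη ηλ λλ = c , f , f-inj , f-col , f-ind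
    where
    f : SpiderV k ℓ → ℕ
    f centre = w
    f (leg i s) = leg′ i (toℕ s)
    ρ : SpiderV k ℓ → R
    ρ centre = η
    ρ (leg i s) = λ′ i (toℕ s)
    f-role : ∀ v → role (f v) ≡ ρ v
    f-role centre = w-role
    f-role (leg i s) = leg-role i (Fin.toℕ<n s)
    ρ-inj : Injective _≡_ _≡_ ρ
    ρ-inj {centre} {centre} e = refl
    ρ-inj {centre} {leg i s} e = contradiction e η≢λ
    ρ-inj {leg i s} {centre} e = contradiction (sym e) η≢λ
    ρ-inj {leg i s} {leg j t} e with λ-inj e
    ... | refl , st = cong (leg i) (Fin.toℕ-injective st)
    f-inj : Injective _≡_ _≡_ f
    f-inj {u} {v} e = ρ-inj (trans (sym (f-role u)) (trans (cong role e) (f-role v)))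
    arc-col : ∀ {u v} → SpiderArc u v → Col P (f u) (f v) c
    arc-col (root i s e) rewrite e = root-col i (ℕ.≤-<-trans z≤n (Fin.toℕ<n s))
    arc-col (next i s t e) = subst (λ r → Col P _ (leg′ i r) c) e
      (leg-col i (subst (_< ℓ) (sym e) (Fin.toℕ<n t)))
    f-col : ∀ u v → SpiderAdj k ℓ u v → Col P (f u) (f v) c
    f-col u v (inj₁ a) = arc-col a
    f-col u v (inj₂ a) = col-sym {P} (arc-col a)
    ρ-ind : ∀ u v → SymClosure Arc (ρ u) (ρ v) → SpiderAdj k ℓ u v
    ρ-ind centre centre a = contradiction a ηη
    ρ-ind centre (leg i s) a = inj₁ (root i s (ηλ a))
    ρ-ind (leg i s) centre a = inj₂ (root i s (ηλ (Sym.symmetric Arc a)))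
    ρ-ind (leg i s) (leg j t) a with λλ a
    ... | refl , inj₁ e = inj₁ (next i s t e)
    ... | refl , inj₂ e = inj₂ (next i t s e)
    f-ind : ∀ u v → Adj P (f u) (f v) → SpiderAdj k ℓ u v
    f-ind u v a = ρ-ind u v (subst₂ (SymClosure Arc) (f-role u) (f-role v) (resp a))

pigeonhole : ∀ n {a b} → a + b ≤ n → (c : Colour) (χ : Fin n → Colour) →
  (Σ (Fin a → Fin n) λ J → Injective _≡_ _≡_ J × (∀ x → χ (J x) ≡ c)) ⊎
  (Σ (Fin b → Fin n) λ J → Injective _≡_ _≡_ J × (∀ x → χ (J x) ≡ not c))
pigeonhole n {zero} _ c χ = inj₁ ((λ ()) , (λ { {()} }) , λ ())
pigeonhole n {suc a} {zero} _ c χ = inj₂ ((λ ()) , (λ { {()} }) , λ ())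
pigeonhole (suc n) {suc a} {suc b} (s≤s le) c χ with χ zero Bool.≟ c
... | yes e = Sum.map
      (λ { (J , inj , cs) → lift 1 J , Fin.lift-injective J inj 1 , λ { zero → e ; (suc x) → cs x } })
      (λ { (J , inj , cs) → suc ∘ J , inj ∘ Fin.suc-injective , cs })
      (pigeonhole n le c (χ ∘ suc))
... | no ne = Sum.map
      (λ { (J , inj , cs) → suc ∘ J , inj ∘ Fin.suc-injective , cs })
      (λ { (J , inj , cs) → lift 1 J , Fin.lift-injective J inj 1 , λ { zero → Bool.¬-not ne ; (suc x) → cs x } })
      (pigeonhole n {suc a} {b} (subst (_≤ n) (ℕ.+-suc a b) le) c (χ ∘ suc))

-- Roles for the spider

even : ℕ → Bool
even zero = true
even (suc n) = not (even n)

-- The parity of `⌊s/2⌋`. A leg visits segments at even depths, and consecutive visits alternate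
-- between two groups of segments.
side : ℕ → Bool
side 0 = false
side 1 = false
side (suc (suc s)) = not (side s)

side-alternates : ∀ s → side (suc (suc s)) ≢ side s
side-alternates s e = Bool.not-¬ refl (sym e)

data SpiderRole : Set where
  off top : SpiderRole
  hub : (i s : ℕ) → SpiderRole
  seg : (e : Bool) (i j p : ℕ) → SpiderRole

-- A segment is entered at the position `p` equal to the current depth in the leg, so `hub i s`
-- meets segments at `s - 1` and `s + 1` only.
data SpiderLink : SpiderRole → SpiderRole → Set where
  off   : ∀ {b} → SpiderLink off b
  seg   : ∀ {e i j p} → SpiderLink (seg e i j p) (seg e i j (suc p))
  top   : ∀ {i j} → SpiderLink top (seg (side 0) i j 0)
  forth : ∀ {i j s} → SpiderLink (hub i s) (seg (side (suc s)) i j (suc s))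
  back  : ∀ {i j s} → SpiderLink (hub i (suc s)) (seg (side s) i j s)

endRole : ℕ → ℕ → SpiderRole
endRole i zero = top
endRole i (suc s) = hub i s

-- Hubs, at odd depths, enter the leg with the placeholder index 0 for `j`.
legRole : ℕ → ℕ → ℕ → SpiderRole
legRole i j s with even s
... | true = seg (side s) i j s
... | false = hub i s

Joined : SpiderRole → SpiderRole → Set
Joined = SymClosure SpiderLink

end-seg : ∀ {i s j} → Joined (endRole i s) (seg (side s) i j s)
end-seg {s = zero} = fwd top
end-seg {s = suc s} = fwd forth

-- The segment vertex behind a hub lies below the position from which the candidate legs ascend.
end-apart : ∀ {i s e j r} → Joined (endRole i s) (seg e i j (s + r)) → r ≡ 0
end-apart {s = zero} (fwd top) = refl
end-apart {s = zero} (bwd ())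
end-apart {s = suc s} (fwd a) = go a refl
  where
  go : ∀ {i s e j p r} → SpiderLink (hub i s) (seg e i j p) → p ≡ suc s + r → r ≡ 0
  go {s = s} (forth) e = sym (ℕ.+-cancelˡ-≡ (suc s) 0 _ (trans (ℕ.+-identityʳ (suc s)) e))
  go {s = suc s} back e = contradiction e (ℕ.m≢1+m+n s ∘ λ q → trans q (cong suc (sym (ℕ.+-suc s _))) )
end-apart {s = suc s} (bwd ())

-- The segment vertices on the two sides of a hub lie in different segments.
hub-apart : ∀ {i s j r} → Joined (hub i (suc s)) (seg (side s) i j (s + r)) → r ≡ 0
hub-apart {s = s} (fwd a) = go a refl refl
  where
  go : ∀ {i e j p r} → SpiderLink (hub i (suc s)) (seg e i j p) → e ≡ side s → p ≡ s + r → r ≡ 0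
  go forth e _ = contradiction e (side-alternates s)
  go back _ e = sym (ℕ.+-cancelˡ-≡ s 0 _ (trans (ℕ.+-identityʳ s) e))
hub-apart (bwd ())

end-irreflexive : ∀ {i s} → ¬ Joined (endRole i s) (endRole i s)
end-irreflexive {s = zero} (fwd ())
end-irreflexive {s = zero} (bwd ())
end-irreflexive {s = suc s} (fwd ())
end-irreflexive {s = suc s} (bwd ())

end≢seg : ∀ {i s e i′ j p} → endRole i s ≢ seg e i′ j p
end≢seg {s = zero} ()
end≢seg {s = suc s} ()

seg-joined : ∀ {e i j p e′ i′ j′ p′} → Joined (seg e i j p) (seg e′ i′ j′ p′) →
  (i ≡ i′ × j ≡ j′) × (suc p ≡ p′ ⊎ suc p′ ≡ p)
seg-joined (fwd seg) = (refl , refl) , inj₁ refl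
seg-joined (bwd seg) = (refl , refl) , inj₂ refl

leg-injective : ∀ {i j s i′ j′ s′} → legRole i j s ≡ legRole i′ j′ s′ → i ≡ i′ × s ≡ s′
leg-injective {s = s} {s′ = s′} e with even s | even s′
leg-injective refl | true | true = refl , refl
leg-injective refl | false | false = refl , refl

hub-joined : ∀ {i s e i′ j p} → Joined (hub i s) (seg e i′ j p) → i ≡ i′ × (suc s ≡ p ⊎ suc p ≡ s)
hub-joined (fwd forth) = refl , inj₁ refl
hub-joined (fwd back) = refl , inj₂ refl
hub-joined (bwd ())

-- Segment vertices of a leg have even depth, while an edge inside a segment changes the position by
-- one, so no such edge joins two of them; nor are two hubs ever joined.
leg-joined : ∀ {i j s i′ j′ s′} → Joined (legRole i j s) (legRole i′ j′ s′) →
  i ≡ i′ × (suc s ≡ s′ ⊎ suc s′ ≡ s)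
leg-joined {s = s} {s′ = s′} a with even s in e | even s′ in e′
leg-joined a | true | true with seg-joined a
... | (refl , _) , inj₁ refl = contradiction (trans e (sym e′)) (Bool.not-¬ refl)
... | (refl , _) , inj₂ refl = contradiction (trans e′ (sym e)) (Bool.not-¬ refl)
leg-joined a | true | false with hub-joined (Sym.symmetric SpiderLink a)
... | refl , p = refl , Sum.swap p
leg-joined a | false | true = hub-joined a
leg-joined (fwd ()) | false | false
leg-joined (bwd ()) | false | false

top-leg : ∀ {i j s} → Joined top (legRole i j s) → s ≡ 0
top-leg {s = s} a with even s
top-leg (fwd top) | true = refl
top-leg (fwd ()) | false
top-leg (bwd ()) | false

top≢leg : ∀ {i j s} → top ≢ legRole i j s
top≢leg {s = s} e with even s
top≢leg () | true
top≢leg () | false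

-- Each leg grows to `2ℓ` vertices in `ℓ` steps of two, whatever the parity of `ℓ`. A spider centred
-- on the way needs `ℓ` consecutive segment vertices from the current depth on, hence segments of
-- length `3ℓ`.
module ForceSpider (k ℓ : ℕ) (0<ℓ : 0 < ℓ) (c : Colour) (P₀ : Position) (role : ℕ → SpiderRole)
  (topV : ℕ) (hubV : Fin k → ℕ → ℕ) (segV : Bool → Fin k → Fin (k + k) → ℕ → ℕ)
  (top-role : role topV ≡ top)
  (hub-role : ∀ i {s} → s < ℓ + ℓ → role (hubV i s) ≡ hub (toℕ i) s)
  (seg-role : ∀ e i j {p} → p < ℓ + ℓ + ℓ → role (segV e i j p) ≡ seg e (toℕ i) (toℕ j) p)
  (seg-col : ∀ e i j {p} → suc p < ℓ + ℓ + ℓ → Col P₀ (segV e i j p) (segV e i j (suc p)) c)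
  where

  open Game (SpiderV k ℓ) (SpiderAdj k ℓ)

  Good : Position → Set
  Good P = P₀ ⊑ P × Respects SpiderLink role P

  K : ℕ → ℕ → Set
  K x y = Joined (role x) (role y)

  K-sym : Symmetric K
  K-sym = Sym.symmetric SpiderLink

  -- The legs ascend from position `p` in the chosen segments. That `η` meets these stretches only
  -- at their start keeps the star induced.
  starCopy : ∀ {P w η e i p} {J : Fin k → Fin (k + k)} → Good P → Injective _≡_ _≡_ J →
    role w ≡ η → p + ℓ ≤ ℓ + ℓ + ℓ → (∀ {i j q} → η ≢ seg e i j q) → ¬ Joined η η →
    (∀ {j s} → Joined η (seg e (toℕ i) j (p + s)) → s ≡ 0) →
    (∀ a → Col P w (segV e i (J a) p) c) → MonoInducedCopy (SpiderV k ℓ) (SpiderAdj k ℓ) P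
  starCopy {P} {w} {η} {e} {i} {p} {J} (P₀⊑P , resp) J-inj w-role p≤ η≢ ηη ηs cs =
    spiderCopy {leg′ = λ a s → segV e i (J a) (p + s)} {λ′ = λ a s → seg e (toℕ i) (toℕ (J a)) (p + s)}
      resp w-role (λ a s< → seg-role e i (J a) (below s<)) η≢
      inj
      (λ a _ → subst (λ q → Col P w (segV e i (J a) q) c) (sym (ℕ.+-identityʳ p)) (cs a))
      (λ a {s} s< → subst (λ q → Col P (segV e i (J a) (p + s)) (segV e i (J a) q) c) (sym (ℕ.+-suc p s))
         (P₀⊑P (seg-col e i (J a) (subst (_< ℓ + ℓ + ℓ) (ℕ.+-suc p s) (below s<)))))
      ηη ηs joined
    where
    below : ∀ {s} → s < ℓ → p + s < ℓ + ℓ + ℓ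
    below s< = ℕ.<-≤-trans (ℕ.+-monoʳ-< p s<) p≤
    inj : ∀ {a b s t} → seg e (toℕ i) (toℕ (J a)) (p + s) ≡ seg e (toℕ i) (toℕ (J b)) (p + t) → a ≡ b × s ≡ t
    inj {a} {b} {s} {t} q = J-inj (Fin.toℕ-injective (cong (λ { (seg _ _ j _) → j ; _ → 0 }) q)) ,
      ℕ.+-cancelˡ-≡ p s t (cong (λ { (seg _ _ _ x) → x ; _ → 0 }) q)
    joined : ∀ {a b s t} → Joined (seg e (toℕ i) (toℕ (J a)) (p + s)) (seg e (toℕ i) (toℕ (J b)) (p + t)) →
      a ≡ b × (suc s ≡ t ⊎ suc t ≡ s)
    joined {a} {b} {s} {t} l with seg-joined l
    ... | (_ , jj) , pp = J-inj (Fin.toℕ-injective jj) ,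
      Sum.map (λ q → ℕ.+-cancelˡ-≡ p _ _ (trans (ℕ.+-suc p s) q))
              (λ q → ℕ.+-cancelˡ-≡ p _ _ (trans (ℕ.+-suc p t) q)) pp

  -- The chain links each vertex to the one before; the first has none, so its link to the centre is
  -- recorded here.
  LegAt : Position → Fin k → ℕ → ℕ × ℕ → Set
  LegAt P i s (x , j) = role x ≡ legRole (toℕ i) j s × (s ≡ 0 → Col P topV x (not c))

  Leg : Position → Fin k → List (ℕ × ℕ) → Set
  Leg P i = Chain proj₁ P (not c) (LegAt P i)

  leg-mono : ∀ {P Q i} xs → P ⊑ Q → Leg P i xs → Leg Q i xs
  leg-mono xs le = chain-map proj₁ xs le λ { _ (e , f) → e , le ∘ f }

  end : List (ℕ × ℕ) → ℕ
  end [] = topV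
  end ((x , _) ∷ _) = x

  Tip : Fin k → List (ℕ × ℕ) → Set
  Tip i xs = even (length xs) ≡ true × role (end xs) ≡ endRole (toℕ i) (length xs)

  join-end : ∀ {P i x j} xs → Leg P i xs → role x ≡ legRole (toℕ i) j (length xs) →
    Col P x (end xs) (not c) → Leg P i ((x , j) ∷ xs)
  join-end {P} [] ch e cl = tt , (e , λ _ → col-sym {P} cl) , tt
  join-end (_ ∷ _) ch e cl = ch , (e , λ ()) , cl

  legRole-even : ∀ {i j s} → even s ≡ true → legRole i j s ≡ seg (side s) i j s
  legRole-even {s = s} e with even s
  ... | true = refl
  legRole-odd : ∀ {i j s} → even s ≡ false → legRole i j s ≡ hub i s
  legRole-odd {s = s} e with even s
  ... | false = refl

  extendLeg : ∀ {m P} i xs → suc (length xs) < ℓ + ℓ → Good P → Leg P i xs → Tip i xs →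
    (∀ {Q} x y j → P ⊑ Q → Good Q → Leg Q i ((x , 0) ∷ (y , j) ∷ xs) → Tip i ((x , 0) ∷ (y , j) ∷ xs) → Wins m Q) →
    Wins (k + k + (k + m)) P
  extendLeg {m} {P} i xs s< (P₀⊑P , resp) ch (s-even , end-role) cont =
    probe (k + k) target K-sym resp
      (λ j → subst₂ Joined (sym end-role) (sym (target-role j)) end-seg)
      (λ j e → end≢seg {s = s} (trans (sym end-role) (trans (cong role e) (target-role j))))
      λ χ le₁ resp₁ es → afterForward le₁ resp₁ (Sum.map
        (λ { (J , J-inj , cs) → J , J-inj , λ a → subst (Col _ w (target (J a))) (cs a) (es (J a)) })
        (λ { (J , J-inj , cs) → J , J-inj , λ a → subst (Col _ w (target (J a))) (cs a) (es (J a)) })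
        (pigeonhole (k + k) ℕ.≤-refl c χ))
    where
    s w x : ℕ
    s = length xs
    w = end xs
    x = hubV i (suc s)
    target : Fin (k + k) → ℕ
    target j = segV (side s) i j s
    s+ℓ≤ : s + ℓ ≤ ℓ + ℓ + ℓ
    s+ℓ≤ = ℕ.+-monoˡ-≤ ℓ (ℕ.<⇒≤ (ℕ.<⇒≤ s<))
    target-role : ∀ j → role (target j) ≡ seg (side s) (toℕ i) (toℕ j) s
    target-role j = seg-role (side s) i j (ℕ.<-≤-trans (ℕ.<⇒≤ s<) (ℕ.m≤m+n (ℓ + ℓ) ℓ))
    x-role : role x ≡ hub (toℕ i) (suc s)
    x-role = hub-role i s<
    Spokes : Colour → Position → Set
    Spokes c′ Q = Σ (Fin k → Fin (k + k)) λ J → Injective _≡_ _≡_ J × (∀ a → Col Q w (target (J a)) c′)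
    afterForward : ∀ {Q} → P ⊑ Q → Respects SpiderLink role Q → Spokes c Q ⊎ Spokes (not c) Q → Wins (k + m) Q
    afterForward le₁ resp₁ (inj₁ (J , J-inj , cs)) = done (starCopy {i = i} (⊑-trans {P₀} P₀⊑P le₁ , resp₁) J-inj end-role s+ℓ≤
      (end≢seg {s = s}) (end-irreflexive {s = s}) end-apart cs)
    afterForward {Q} le₁ resp₁ (inj₂ (J , J-inj , cs)) =
      probe k (target ∘ J) K-sym resp₁
        (λ a → subst₂ Joined (sym x-role) (sym (target-role (J a))) (fwd back))
        (λ a e → case trans (sym x-role) (trans (cong role e) (target-role (J a))) of λ ())
        λ χ le₂ resp₂ es → afterBack (⊑-trans {P} le₁ le₂) le₂ resp₂ (case Fin.any? (λ a → χ a Bool.≟ not c) of λ where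
          (yes (a , e)) → inj₂ (a , subst (Col _ x (target (J a))) e (es a))
          (no ¬e) → inj₁ λ a → subst (Col _ x (target (J a)))
            (trans (Bool.¬-not λ e → ¬e (a , e)) (Bool.not-involutive c)) (es a))
      where
      afterBack : ∀ {S} → P ⊑ S → Q ⊑ S → Respects SpiderLink role S →
        (∀ a → Col S x (target (J a)) c) ⊎ (Σ (Fin k) λ a → Col S x (target (J a)) (not c)) → Wins m S
      -- The segments selected by the `not c` spokes at `w` serve again, now as legs around `x`.
      afterBack le le₂ resp₂ (inj₁ cs′) = done (starCopy {i = i} (⊑-trans {P₀} P₀⊑P le , resp₂) J-inj x-role s+ℓ≤
        (λ ()) (λ { (fwd ()) ; (bwd ()) }) hub-apart cs′)
      afterBack {S} le le₂ resp₂ (inj₂ (a , cl)) =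
        cont x (target (J a)) (toℕ (J a)) le (⊑-trans {P₀} P₀⊑P le , resp₂)
          (join-end ((target (J a) , toℕ (J a)) ∷ xs)
            (join-end xs (leg-mono xs le ch) (trans (target-role (J a)) (sym (legRole-even s-even)))
              (col-sym {S} (le₂ (cs a))))
            (trans x-role (sym (legRole-odd {s = suc s} (cong not s-even)))) cl)
          (trans (Bool.not-involutive _) s-even , x-role)

  FullLeg : Fin k → Position → Set
  FullLeg i P = Σ (List (ℕ × ℕ)) λ xs → Leg P i xs × ℓ ≤ length xs

  growLeg : ∀ t {m P} i xs → length xs + (t + t) ≡ ℓ + ℓ → Good P → Leg P i xs → Tip i xs →
    (∀ {Q} → P ⊑ Q → Good Q → FullLeg i Q → Wins m Q) → Wins (t * (k + k + k) + m) P
  growLeg zero i xs len good ch tip cont = cont id good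
    (xs , ch , subst (ℓ ≤_) (trans (sym len) (ℕ.+-identityʳ _)) (ℕ.m≤m+n ℓ ℓ))
  growLeg (suc t) {m} {P} i xs len good ch tip cont =
    subst (λ n → Wins n P) (rounds k (t * (k + k + k)) m)
    (extendLeg i xs (ℕ.<-≤-trans (ℕ.m<m+n (suc (length xs)) (s≤s z≤n)) (ℕ.≤-reflexive len′)) good ch tip
      λ x y j le good′ ch′ tip′ → growLeg t i ((x , 0) ∷ (y , j) ∷ xs) (trans len″ len) good′ ch′ tip′
        λ le′ → cont (⊑-trans {P} le le′))
    where
    rounds : ∀ k r m → k + k + (k + (r + m)) ≡ k + k + k + r + m
    rounds = solve-∀
    len″ : suc (suc (length xs)) + (t + t) ≡ length xs + (suc t + suc t)
    len″ = l (length xs) t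
      where
      l : ∀ a t → suc (suc a) + (t + t) ≡ a + (suc t + suc t)
      l = solve-∀
    len′ : suc (length xs) + suc (t + t) ≡ ℓ + ℓ
    len′ = trans (l (length xs) t) len
      where
      l : ∀ a t → suc a + suc (t + t) ≡ a + (suc t + suc t)
      l = solve-∀

  -- A finished leg consists of roles and coloured edges, which later moves cannot spoil;
  -- inducedness is carried by `Good` instead.
  growAll : ∀ n b {m P} {Done : Fin n → Position → Set} → (∀ {i P Q} → P ⊑ Q → Done i P → Done i Q) →
    (∀ i {m P} → Good P → (∀ {Q} → P ⊑ Q → Good Q → Done i Q → Wins m Q) → Wins (b + m) P) →
    Good P → (∀ {Q} → P ⊑ Q → Good Q → (∀ i → Done i Q) → Wins m Q) → Wins (n * b + m) P
  growAll zero b mono each good cont = cont id good λ ()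
  growAll (suc n) b {m} {P} {Done} mono each good cont =
    subst (λ r → Wins r P) (sym (ℕ.+-assoc b (n * b) m))
    (each zero good λ le₁ good₁ d →
      growAll n b mono (λ i → each (suc i)) good₁ λ le₂ good₂ ds →
        cont (⊑-trans {P} le₁ le₂) good₂ λ { zero → mono le₂ d ; (suc i) → ds i })

  finish : ∀ {P} → Good P → (∀ i → FullLeg i P) → MonoInducedCopy (SpiderV k ℓ) (SpiderAdj k ℓ) P
  finish {P} (_ , resp) legs =
    spiderCopy {leg′ = λ i s → proj₁ (f i s)} {λ′ = λ i s → legRole (toℕ i) (proj₂ (f i s)) s} resp
      top-role (λ i s< → proj₁ (f-at i (long i s<))) top≢leg
      (λ {i} {j} {s} e → let ij , st = leg-injective {s = s} e in Fin.toℕ-injective ij , st)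
      (λ i lt → proj₂ (f-at i (long i lt)) refl)
      (λ i s< → f-col i (long i s<))
      (λ { (fwd ()) ; (bwd ()) }) top-leg
      (λ {i} {j} {s} l → let ij , st = leg-joined {s = s} l in Fin.toℕ-injective ij , st)
    where
    long : ∀ i {s} → s < ℓ → s < length (proj₁ (legs i))
    long i s< = ℕ.<-≤-trans s< (proj₂ (proj₂ (legs i)))
    looked : ∀ i → _
    looked i = chain-lookup proj₁ (proj₁ (legs i)) (long i 0<ℓ) (proj₁ (proj₂ (legs i)))
    f : Fin k → ℕ → ℕ × ℕ
    f i = proj₁ (looked i)
    f-at : ∀ i {s} → s < length (proj₁ (legs i)) → LegAt P i s (f i s)
    f-at i = proj₁ (proj₂ (looked i))
    f-col : ∀ i {s} → suc s < length (proj₁ (legs i)) → Col P (proj₁ (f i s)) (proj₁ (f i (suc s))) (not c)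
    f-col i = proj₁ (proj₂ (proj₂ (looked i)))

  forceSpider : Respects SpiderLink role P₀ → Wins (k * (ℓ * (k + k + k)) + 0) P₀
  forceSpider resp = growAll k (ℓ * (k + k + k)) {Done = FullLeg}
    (λ { le (xs , ch , len) → xs , leg-mono xs le ch , len })
    (λ i good cont → growLeg ℓ i [] refl good tt (refl , top-role) cont)
    (id , resp) (λ _ good legs → done (finish good legs))

-- Cutting the path into segments

quotient : ∀ q {p} n .{{_ : NonZero n}} → p < n → (q * n + p) / n ≡ q
quotient q {p} n p< = trans (ℕ.+-distrib-/-∣ˡ p (n∣m*n q))
  (trans (cong₂ _+_ (ℕ.m*n/n≡m q n) (ℕ.m<n⇒m/n≡0 p<)) (ℕ.+-identityʳ q))

remainder : ∀ q {p} n .{{_ : NonZero n}} → p < n → (q * n + p) % n ≡ p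
remainder q {p} n p< = trans (cong (_% n) (ℕ.+-comm (q * n) p))
  (trans (ℕ.[m+kn]%n≡m%n p q n) (ℕ.m<n⇒m%n≡m p<))

pair-bound : ∀ {q m p n} → q < m → p < n → q * n + p < m * n
pair-bound {q} {m} {p} {n} q< p< = ℕ.<-≤-trans (ℕ.+-monoʳ-< (q * n) p<)
  (ℕ.≤-trans (ℕ.≤-reflexive (ℕ.+-comm (q * n) n)) (ℕ.*-monoˡ-≤ n q<))

bit : Bool → ℕ
bit false = 0
bit true = 1

bit< : ∀ e → bit e < 2
bit< false = s≤s z≤n
bit< true = s≤s (s≤s z≤n)

bit-≡ᵇ : ∀ e → (bit e ≡ᵇ 1) ≡ e
bit-≡ᵇ false = refl
bit-≡ᵇ true = refl

module _ (k ℓ : ℕ) .{{_ : NonZero k}} .{{_ : NonZero (k + k)}} .{{_ : NonZero (ℓ + ℓ)}} where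
  private
    L W : ℕ
    L = ℓ + ℓ + ℓ
    W = suc L

  -- The last vertex of each block of W path vertices is dropped, which separates the blocks.
  segOf : ℕ → SpiderRole
  segOf h with h % W ℕ.≟ L
  ... | yes _ = off
  ... | no _ = seg ((h / W / (k + k) / k) ≡ᵇ 1) ((h / W / (k + k)) % k) ((h / W) % (k + k)) (h % W)

  -- The digits `e`, `i`, `j`, `p` in the mixed radix `2`, `k`, `2k`, `W`; `segOf` recovers them by
  -- division.
  pathIndex : Bool → Fin k → Fin (k + k) → ℕ → ℕ
  pathIndex e i j p = ((bit e * k + toℕ i) * (k + k) + toℕ j) * W + p

  pathIndex-bound : ∀ e i j {p} → p < W → pathIndex e i j p < 2 * k * (k + k) * W
  pathIndex-bound e i j p< = pair-bound (pair-bound (pair-bound (bit< e) (Fin.toℕ<n i)) (Fin.toℕ<n j)) p<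

  segOf-pathIndex : ∀ e i j {p} → p < L → segOf (pathIndex e i j p) ≡ seg e (toℕ i) (toℕ j) p
  segOf-pathIndex e i j {p} p< with pathIndex e i j p % W ℕ.≟ L
  ... | yes eq = contradiction (trans (sym (remainder ((bit e * k + toℕ i) * (k + k) + toℕ j) W (ℕ.m<n⇒m<1+n p<))) eq) (ℕ.<⇒≢ p<)
  ... | no _ rewrite remainder ((bit e * k + toℕ i) * (k + k) + toℕ j) W (ℕ.m<n⇒m<1+n p<)
             | quotient ((bit e * k + toℕ i) * (k + k) + toℕ j) W (ℕ.m<n⇒m<1+n p<)
             | remainder (bit e * k + toℕ i) (k + k) (Fin.toℕ<n j)
             | quotient (bit e * k + toℕ i) (k + k) (Fin.toℕ<n j)
             | remainder (bit e) k (Fin.toℕ<n i)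
             | quotient (bit e) k (Fin.toℕ<n i)
             | bit-≡ᵇ e = refl

  same-block : ∀ h → h % W ≢ L → suc h % W ≡ suc (h % W) × suc h / W ≡ h / W
  same-block h ne = trans (cong (_% W) split) (remainder (h / W) W below) ,
    trans (cong (_/ W) split) (quotient (h / W) W below)
    where
    split : suc h ≡ h / W * W + suc (h % W)
    split = trans (cong suc (trans (ℕ.m≡m%n+[m/n]*n h W) (ℕ.+-comm (h % W) _))) (sym (ℕ.+-suc _ _))
    below : suc (h % W) < W
    below = s≤s (ℕ.≤∧≢⇒< (ℕ.≤-pred (ℕ.m%n<n h W)) ne)

  segOf-next : ∀ h → Joined (segOf h) (segOf (suc h))
  segOf-next h with h % W ℕ.≟ L | suc h % W ℕ.≟ L
  ... | yes _ | _ = fwd off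
  ... | no _ | yes _ = bwd off
  ... | no ne | no _ rewrite proj₁ (same-block h ne) | proj₂ (same-block h ne) = fwd seg

  onPath : PathRole → SpiderRole
  onPath off = off
  onPath (pos h) = segOf h

  onPath-arc : ∀ {a b} → PathArc a b → Joined (onPath a) (onPath b)
  onPath-arc off = fwd off
  onPath-arc (next {h}) = segOf-next h

  -- Roles for the isolated vertices from `bound` on: first the centre, then `2ℓ` places for each
  -- leg.
  hubOf : ℕ → SpiderRole
  hubOf zero = top
  hubOf (suc d) = hub (d / (ℓ + ℓ)) (d % (ℓ + ℓ))

  open Game (SpiderV k ℓ) (SpiderAdj k ℓ)

  pathToSpider : 0 < ℓ → ∀ {P} → LongPath (2 * k * (k + k) * W) P → Wins (k * (ℓ * (k + k + k)) + 0) P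
  pathToSpider 0<ℓ {P} lp = ForceSpider.forceSpider k ℓ 0<ℓ colour P role′ (bound + 0)
    (λ i s → bound + suc (toℕ i * (ℓ + ℓ) + s)) (λ e i j p → vertex (pathIndex e i j p))
    (new 0)
    (λ i s< → trans (new _) (cong₂ hub (quotient (toℕ i) (ℓ + ℓ) s<) (remainder (toℕ i) (ℓ + ℓ) s<)))
    (λ e i j p< → let v< , v-role = vertex-role (pathIndex-bound e i j (ℕ.m<n⇒m<1+n p<)) in
      trans (old v<) (trans (cong onPath v-role) (segOf-pathIndex e i j p<)))
    (λ e i j {p} p< → subst (λ h → Col P (vertex (pathIndex e i j p)) (vertex h) colour)
      (sym (ℕ.+-suc _ p))
      (edge (subst (_< 2 * k * (k + k) * W) (ℕ.+-suc _ p) (pathIndex-bound e i j (ℕ.m<n⇒m<1+n p<)))))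
    λ a → let x< , y< , l = adj a in
      subst₂ Joined (sym (old x<)) (sym (old y<)) (Sym.gfold {S = Joined} (Sym.symmetric _) onPath onPath-arc l)
    where
    open LongPath lp
    role′ : ℕ → SpiderRole
    role′ x with x <? bound
    ... | yes _ = onPath (role x)
    ... | no _ = hubOf (x ∸ bound)
    old : ∀ {x} → x < bound → role′ x ≡ onPath (role x)
    old {x} lt with x <? bound
    ... | yes _ = refl
    ... | no ¬lt = contradiction lt ¬lt
    new : ∀ d → role′ (bound + d) ≡ hubOf d
    new d with (bound + d) <? bound
    ... | yes lt = contradiction lt (ℕ.m+n≮m bound d)
    ... | no _ = cong hubOf (ℕ.m+n∸m≡n bound d)

-- The upper bound

upperBound : ∀ k ℓ → 0 < k → 0 < ℓ → IndOnlineRamseyAtMost k ℓ (1000 * (k * k * ℓ))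
upperBound k@(suc k′) ℓ@(suc ℓ′) 0<k 0<ℓ =
  wins-mono bound (ForcePath.forcePath n _ 0<n (pathToSpider k ℓ 0<ℓ))
  where
  open Game (SpiderV k ℓ) (SpiderAdj k ℓ)
  n : ℕ
  n = 2 * k * (k + k) * suc (ℓ + ℓ + ℓ)
  0<n : 0 < n
  0<n = s≤s z≤n
  open ℕ.≤-Reasoning
  -- The path costs `56 * 4k²(3ℓ + 1)` rounds and the legs `3k²ℓ`; with `1 ≤ ℓ` the sum is at most
  -- `899k²ℓ`, rounded up to 1000.
  bound : 8 * n * 7 + (k * (ℓ * (k + k + k)) + 0) ≤ 1000 * (k * k * ℓ)
  bound = begin
    8 * n * 7 + (k * (ℓ * (k + k + k)) + 0) ≡⟨ e₁ k ℓ ⟩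
    224 * (k * k) * suc (3 * ℓ) + 3 * (k * k * ℓ)
      ≤⟨ ℕ.+-monoˡ-≤ (3 * (k * k * ℓ)) (ℕ.*-monoʳ-≤ (224 * (k * k)) (ℕ.+-monoˡ-≤ (3 * ℓ) 0<ℓ)) ⟩
    224 * (k * k) * (ℓ + 3 * ℓ) + 3 * (k * k * ℓ) ≡⟨ e₂ k ℓ ⟩
    899 * (k * k * ℓ) ≤⟨ ℕ.*-monoˡ-≤ (k * k * ℓ) (ℕ.m≤m+n 899 101) ⟩
    1000 * (k * k * ℓ) ∎
    where
    e₁ : ∀ k ℓ → 8 * (2 * k * (k + k) * suc (ℓ + ℓ + ℓ)) * 7 + (k * (ℓ * (k + k + k)) + 0) ≡
      224 * (k * k) * suc (3 * ℓ) + 3 * (k * k * ℓ)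
    e₁ = solve-∀
    e₂ : ∀ k ℓ → 224 * (k * k) * (ℓ + 3 * ℓ) + 3 * (k * k * ℓ) ≡ 899 * (k * k * ℓ)
    e₂ = solve-∀

-- Painter's strategy

ends : Position → List ℕ
ends [] = []
ends ((x , y , true) ∷ P) = x ∷ y ∷ ends P
ends ((_ , _ , false) ∷ P) = ends P

tally : ℕ → ℕ → ℕ → ℕ
tally z x n with z ℕ.≟ x
... | yes _ = suc n
... | no _ = n

count : ℕ → List ℕ → ℕ
count z [] = 0
count z (x ∷ xs) = tally z x (count z xs)

without : ℕ → List ℕ → List ℕ
without z [] = []
without z (x ∷ xs) with z ℕ.≟ x
... | yes _ = without z xs
... | no _ = x ∷ without z xs

count-without : ∀ z xs → count z xs + length (without z xs) ≡ length xs
count-without z [] = refl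
count-without z (x ∷ xs) with z ℕ.≟ x
... | yes _ = cong suc (count-without z xs)
... | no _ = trans (ℕ.+-suc _ _) (cong suc (count-without z xs))

count-other : ∀ {z w} xs → z ≢ w → count w (without z xs) ≡ count w xs
count-other [] ne = refl
count-other {z} {w} (x ∷ xs) ne with z ℕ.≟ x
... | no _ = cong (tally w x) (count-other xs ne)
... | yes refl with w ℕ.≟ x
...   | yes refl = contradiction refl ne
...   | no _ = count-other xs ne

-- Distinct vertices occupy disjoint sets of entries: deleting the occurrences of `z zero` leaves
-- the other counts unchanged.
spread : ∀ n {d} (z : Fin n → ℕ) → Injective _≡_ _≡_ z → ∀ xs → (∀ a → d ≤ count (z a) xs) → n * d ≤ length xs
spread zero z inj xs le = z≤n
spread (suc n) {d} z inj xs le = begin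
  d + n * d ≤⟨ ℕ.+-mono-≤ (le zero) (spread n (z ∘ suc) (Fin.suc-injective ∘ inj) (without (z zero) xs)
    λ a → subst (d ≤_) (sym (count-other xs λ e → case inj e of λ ())) (le (suc a))) ⟩
  count (z zero) xs + length (without (z zero) xs) ≡⟨ count-without (z zero) xs ⟩
  length xs ∎
  where open ℕ.≤-Reasoning

redDegree : Position → ℕ → ℕ
redDegree P x = count x (ends P)

ends-length : ∀ P → length (ends P) ≤ 2 * length P
ends-length [] = z≤n
ends-length ((x , y , true) ∷ P) = ℕ.≤-trans (s≤s (s≤s (ends-length P))) (ℕ.≤-reflexive (sym (ℕ.*-suc 2 (length P))))
ends-length ((x , y , false) ∷ P) = ℕ.≤-trans (ends-length P) (ℕ.*-monoʳ-≤ 2 (ℕ.n≤1+n (length P)))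

neighbours : Position → ℕ → List ℕ
neighbours [] x = []
neighbours ((_ , _ , false) ∷ P) x = neighbours P x
neighbours ((a , b , true) ∷ P) x with x ℕ.≟ a | x ℕ.≟ b
... | yes _ | yes _ = b ∷ a ∷ neighbours P x
... | yes _ | no _ = b ∷ neighbours P x
... | no _ | yes _ = a ∷ neighbours P x
... | no _ | no _ = neighbours P x

neighbours-length : ∀ P x → length (neighbours P x) ≡ redDegree P x
neighbours-length [] x = refl
neighbours-length ((_ , _ , false) ∷ P) x = neighbours-length P x
neighbours-length ((a , b , true) ∷ P) x with x ℕ.≟ a | x ℕ.≟ b
... | yes _ | yes _ = cong (λ n → suc (suc n)) (neighbours-length P x)
... | yes _ | no _ = cong suc (neighbours-length P x)
... | no _ | yes _ = cong suc (neighbours-length P x)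
... | no _ | no _ = neighbours-length P x

neighbour : ∀ P {x y} → Col P x y true → y ∈ neighbours P x
neighbour [] (inj₁ ())
neighbour [] (inj₂ ())
neighbour ((_ , _ , false) ∷ P) (inj₁ (there e)) = neighbour P (inj₁ e)
neighbour ((_ , _ , false) ∷ P) (inj₂ (there e)) = neighbour P (inj₂ e)
neighbour ((a , b , true) ∷ P) {x} e with x ℕ.≟ a | x ℕ.≟ b | e
... | yes _ | yes _ | inj₁ (here refl) = here refl
... | yes _ | yes _ | inj₂ (here refl) = there (here refl)
... | yes _ | yes _ | inj₁ (there m) = there (there (neighbour P (inj₁ m)))
... | yes _ | yes _ | inj₂ (there m) = there (there (neighbour P (inj₂ m)))
... | yes _ | no _ | inj₁ (here refl) = here refl
... | yes _ | no ne | inj₂ (here refl) = contradiction refl ne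
... | yes _ | no _ | inj₁ (there m) = there (neighbour P (inj₁ m))
... | yes _ | no _ | inj₂ (there m) = there (neighbour P (inj₂ m))
... | no ne | yes _ | inj₁ (here refl) = contradiction refl ne
... | no _ | yes _ | inj₂ (here refl) = here refl
... | no _ | yes _ | inj₁ (there m) = there (neighbour P (inj₁ m))
... | no _ | yes _ | inj₂ (there m) = there (neighbour P (inj₂ m))
... | no ne | no _ | inj₁ (here refl) = contradiction refl ne
... | no _ | no ne | inj₂ (here refl) = contradiction refl ne
... | no _ | no _ | inj₁ (there m) = neighbour P (inj₁ m)
... | no _ | no _ | inj₂ (there m) = neighbour P (inj₂ m)

-- Distinct neighbours have distinct indices in `neighbours P x`.
redDegree-≥ : ∀ P {x n} (y : Fin n → ℕ) → Injective _≡_ _≡_ y → (∀ a → Col P x (y a) true) → n ≤ redDegree P x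
redDegree-≥ P {x} y inj es = subst (_ ≤_) (neighbours-length P x)
  (Fin.injective⇒≤ {f = λ a → index (neighbour P (es a))}
    λ {a} {b} e → inj (Membership.index-injective (setoid ℕ) (neighbour P (es a)) (neighbour P (es b)) e))

Saturated : ℕ → Position → ℕ → Set
Saturated d P x = d ≤ redDegree P x

-- Used with `d = k - 1`. Red degrees never drop, so a saturated endpoint stays saturated.
record Guarded (d : ℕ) (P : Position) : Set where
  field
    degree : ∀ x → redDegree P x ≤ d
    cover : ∀ {x y} → Col P x y false → Saturated d P x ⊎ Saturated d P y

tally-≤ : ∀ {d} z x n → n ≤ d → (z ≡ x → n < d) → tally z x n ≤ d
tally-≤ z x n le lt with z ℕ.≟ x
... | yes e = lt e
... | no _ = le

tally-≥ : ∀ z x n → n ≤ tally z x n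
tally-≥ z x n with z ℕ.≟ x
... | yes _ = ℕ.n≤1+n n
... | no _ = ℕ.≤-refl

tally-≢ : ∀ {z x n} → z ≢ x → tally z x n ≡ n
tally-≢ {z} {x} ne with z ℕ.≟ x
... | yes e = contradiction e ne
... | no _ = refl

guarded-red : ∀ {d P x y} → x ≢ y → redDegree P x < d → redDegree P y < d → Guarded d P → Guarded d ((x , y , true) ∷ P)
guarded-red {d} {P} {x} {y} x≢y x< y< g = record
  { degree = λ z → tally-≤ z x _ (tally-≤ z y _ (degree z) λ { refl → y< })
      λ { refl → subst (_< d) (sym (tally-≢ x≢y)) x< }
  ; cover = λ where
      (inj₁ (there e)) → up (cover (inj₁ e))
      (inj₂ (there e)) → up (cover (inj₂ e)) }
  where
  open Guarded g
  up₁ : ∀ {z} → Saturated d P z → Saturated d ((x , y , true) ∷ P) z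
  up₁ {z} s = ℕ.≤-trans s (ℕ.≤-trans (tally-≥ z y _) (tally-≥ z x _))
  up : ∀ {a b} → Saturated d P a ⊎ Saturated d P b → Saturated d ((x , y , true) ∷ P) a ⊎ Saturated d ((x , y , true) ∷ P) b
  up (inj₁ s) = inj₁ (up₁ s)
  up (inj₂ s) = inj₂ (up₁ s)

guarded-blue : ∀ {d P x y} → Saturated d P x ⊎ Saturated d P y → Guarded d P → Guarded d ((x , y , false) ∷ P)
guarded-blue s g = record
  { degree = degree
  ; cover = λ where
      (inj₁ (here refl)) → s
      (inj₁ (there e)) → cover (inj₁ e)
      (inj₂ (here refl)) → [ inj₂ , inj₁ ]′ s
      (inj₂ (there e)) → cover (inj₂ e) }
  where open Guarded g

answer : ∀ {d P x y} → x ≢ y → Guarded d P → ∃ λ c → Guarded d ((x , y , c) ∷ P)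
answer {d} {P} {x} {y} x≢y g with redDegree P x <? d | redDegree P y <? d
... | yes x< | yes y< = true , guarded-red x≢y x< y< g
... | no x≮ | _ = false , guarded-blue (inj₁ (ℕ.≮⇒≥ x≮)) g
... | yes _ | no y≮ = false , guarded-blue (inj₂ (ℕ.≮⇒≥ y≮)) g

-- Counting the red edges a copy requires

double-< : ∀ {a n} → a < ⌊ n /2⌋ → suc (a + a) < n
double-< {zero} {suc (suc n)} _ = s≤s (s≤s z≤n)
double-< {suc a} {suc (suc n)} (s≤s lt) = s≤s (s≤s (subst (_< n) (sym (ℕ.+-suc a a)) (double-< lt)))

double-injective : ∀ {a b} → a + a ≡ b + b → a ≡ b
double-injective {zero} {zero} e = refl
double-injective {suc a} {suc b} e = cong suc (double-injective (ℕ.suc-injective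
  (trans (sym (ℕ.+-suc a a)) (trans (ℕ.suc-injective e) (ℕ.+-suc b b)))))

double-≢ : ∀ a b → a + a ≢ suc (b + b)
double-≢ (suc a) zero e = contradiction (ℕ.suc-injective e) λ e → case trans (sym (ℕ.+-suc a a)) e of λ ()
double-≢ (suc a) (suc b) e = double-≢ a b (ℕ.suc-injective (trans (sym (ℕ.+-suc a a)) (trans (ℕ.suc-injective e) (cong suc (ℕ.+-suc b b)))))

module _ {k ℓ d : ℕ} (d<k : d < k) (0<ℓ : 0 < ℓ) where

  copy-cost : ∀ {P} → Guarded d P → MonoInducedCopy (SpiderV k ℓ) (SpiderAdj k ℓ) P →
    k * ⌊ ℓ /2⌋ * d ≤ 2 * length P
  copy-cost {P} g (true , f , f-inj , f-col , _) = contradiction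
    (ℕ.≤-trans (redDegree-≥ P (λ i → f (leg i (fromℕ< 0<ℓ))) (λ e → case f-inj e of λ { refl → refl })
      λ i → f-col centre (leg i _) (inj₁ (root i _ (Fin.toℕ-fromℕ< 0<ℓ)))) (Guarded.degree g (f centre)))
    (ℕ.<⇒≱ d<k)
  copy-cost {P} g (false , f , f-inj , f-col , _) =
    ℕ.≤-trans (spread (k * h) z z-inj (ends P) (λ a → proj₂ (covered a))) (ends-length P)
    where
    h : ℕ
    h = ⌊ ℓ /2⌋
    -- Edge `a` of a leg joins the indices `2a` and `2a + 1`; these edges avoid the centre and each
    -- other.
    near far : Fin h → Fin ℓ
    near a = fromℕ< (ℕ.<⇒≤ (double-< (Fin.toℕ<n a)))
    far a = fromℕ< (double-< (Fin.toℕ<n a))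
    toℕ-near : ∀ a → toℕ (near a) ≡ toℕ a + toℕ a
    toℕ-near a = Fin.toℕ-fromℕ< _
    toℕ-far : ∀ a → toℕ (far a) ≡ suc (toℕ a + toℕ a)
    toℕ-far a = Fin.toℕ-fromℕ< _
    Endpoint : Fin k × Fin h → SpiderV k ℓ → Set
    Endpoint (i , a) v = v ≡ leg i (near a) ⊎ v ≡ leg i (far a)
    covered′ : ∀ ia → Σ (SpiderV k ℓ) λ v → Endpoint ia v × Saturated d P (f v)
    covered′ (i , a) = case Guarded.cover g (f-col (leg i (near a)) (leg i (far a))
        (inj₁ (next i _ _ (trans (cong suc (toℕ-near a)) (sym (toℕ-far a)))))) of λ where
      (inj₁ s) → _ , inj₁ refl , s
      (inj₂ s) → _ , inj₂ refl , s
    covered : ∀ (a : Fin (k * h)) → Σ (Endpoint (remQuot {k} h a) (proj₁ (covered′ (remQuot {k} h a)))) λ _ →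
      Saturated d P (f (proj₁ (covered′ (remQuot {k} h a))))
    covered a = proj₂ (covered′ (remQuot {k} h a))
    z : Fin (k * h) → ℕ
    z a = f (proj₁ (covered′ (remQuot {k} h a)))
    leg-inj : ∀ {i j : Fin k} {s t : Fin ℓ} → leg i s ≡ leg j t → i ≡ j × toℕ s ≡ toℕ t
    leg-inj refl = refl , refl
    -- Disjointness of the edges: parity separates `near` from `far`, and halving recovers `a`.
    same : ∀ ia jb {v} → Endpoint ia v → Endpoint jb v → ia ≡ jb
    same (_ , a) (_ , b) (inj₁ refl) (inj₁ e) = let ij , st = leg-inj e in
      cong₂ _,_ ij (Fin.toℕ-injective (double-injective (trans (sym (toℕ-near a)) (trans st (toℕ-near b)))))
    same (_ , a) (_ , b) (inj₂ refl) (inj₂ e) = let ij , st = leg-inj e in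
      cong₂ _,_ ij (Fin.toℕ-injective (double-injective (ℕ.suc-injective (trans (sym (toℕ-far a)) (trans st (toℕ-far b))))))
    same (_ , a) (_ , b) (inj₁ refl) (inj₂ e) = contradiction
      (trans (sym (toℕ-near a)) (trans (proj₂ (leg-inj e)) (toℕ-far b))) (double-≢ (toℕ a) (toℕ b))
    same (_ , a) (_ , b) (inj₂ refl) (inj₁ e) = contradiction
      (sym (trans (sym (toℕ-far a)) (trans (proj₂ (leg-inj e)) (toℕ-near b)))) (double-≢ (toℕ b) (toℕ a))
    z-inj : Injective _≡_ _≡_ z
    z-inj {a} {b} e = trans (sym (Fin.combine-remQuot {k} h a)) (trans (cong (λ { (i , c) → combine i c })
      (same (remQuot {k} h a) (remQuot {k} h b) (proj₁ (covered a))
        (subst (Endpoint (remQuot {k} h b)) (sym (f-inj e)) (proj₁ (covered b)))))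
      (Fin.combine-remQuot {k} h b))

  -- `length P + m` is constant, as each round moves one unit from `m` to `length P`.
  play : ∀ {m P} → Guarded d P → BuilderWins (SpiderV k ℓ) (SpiderAdj k ℓ) m P →
    k * ⌊ ℓ /2⌋ * d ≤ 2 * (length P + m)
  play {m} {P} g (done c) = ℕ.≤-trans (copy-cost g c) (ℕ.*-monoʳ-≤ 2 (ℕ.m≤m+n (length P) m))
  play {suc m} {P} g (step x y x≢y _ next′) with answer x≢y g
  ... | c , g′ = subst (λ n → k * ⌊ ℓ /2⌋ * d ≤ 2 * n) (sym (ℕ.+-suc (length P) m)) (play g′ (next′ c))

-- The factor 3 is attained at `n = 3`.
half-≥ : ∀ {n} → 2 ≤ n → n ≤ 3 * ⌊ n /2⌋
half-≥ {suc (suc zero)} (s≤s (s≤s _)) = s≤s (s≤s z≤n)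
half-≥ {suc (suc (suc zero))} _ = ℕ.≤-refl
half-≥ {suc (suc n@(suc (suc _)))} _ = begin
  2 + n ≤⟨ ℕ.+-mono-≤ (ℕ.n≤1+n 2) (half-≥ {n} (s≤s (s≤s z≤n))) ⟩
  3 + 3 * ⌊ n /2⌋ ≡⟨ ℕ.*-suc 3 ⌊ n /2⌋ ⟨
  3 * suc ⌊ n /2⌋ ∎
  where open ℕ.≤-Reasoning

lowerBound : ∀ k ℓ m → 3 ≤ k → 2 ≤ ℓ → IndOnlineRamseyAtMost k ℓ m → 1 * (k * k * ℓ) ≤ 9 * m
lowerBound k@(suc d) ℓ m (s≤s 2≤d) 2≤ℓ win = ℕ.*-cancelˡ-≤ 2 (begin
  2 * (1 * (k * k * ℓ)) ≡⟨ e₁ k ℓ ⟩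
  -- The final 9 is `3 * 3`: one 3 from replacing `ℓ` by `⌊ ℓ /2⌋`, the other from `2k ≤ 3(k - 1)`,
  -- where `k ≥ 3` enters.
  k * ℓ * (2 * k) ≤⟨ ℕ.*-mono-≤ (ℕ.*-monoʳ-≤ k (half-≥ 2≤ℓ)) 2k≤3d ⟩
  k * (3 * ⌊ ℓ /2⌋) * (3 * d) ≡⟨ e₂ k ⌊ ℓ /2⌋ d ⟩
  9 * (k * ⌊ ℓ /2⌋ * d) ≤⟨ ℕ.*-monoʳ-≤ 9 (play ℕ.≤-refl (ℕ.<⇒≤ 2≤ℓ) guarded-[] win) ⟩
  9 * (2 * m) ≡⟨ e₃ m ⟩
  2 * (9 * m) ∎)
  where
  open ℕ.≤-Reasoning
  guarded-[] : Guarded d []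
  guarded-[] = record { degree = λ _ → z≤n ; cover = λ { (inj₁ ()) ; (inj₂ ()) } }
  2k≤3d : 2 * k ≤ 3 * d
  2k≤3d = begin
    2 * suc d ≡⟨ ℕ.*-suc 2 d ⟩
    2 + 2 * d ≤⟨ ℕ.+-monoˡ-≤ (2 * d) 2≤d ⟩
    3 * d ∎
  e₁ : ∀ k ℓ → 2 * (1 * (k * k * ℓ)) ≡ k * ℓ * (2 * k)
  e₁ = solve-∀
  e₂ : ∀ k h d → k * (3 * h) * (3 * d) ≡ 9 * (k * h * d)
  e₂ = solve-∀
  e₃ : ∀ m → 9 * (2 * m) ≡ 2 * (9 * m)
  e₃ = solve-∀

theorem5 : Σ ℕ λ a → Σ ℕ λ b → Σ ℕ λ C →
    a > 0 × b > 0 × C > 0 ×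
    (∀ (k ℓ : ℕ) → k ≥ 3 → ℓ ≥ 2 →
    IndOnlineRamseyAtMost k ℓ (C * (k * k * ℓ)) ×
    (∀ m → IndOnlineRamseyAtMost k ℓ m → a * (k * k * ℓ) ≤ b * m))
theorem5 = 1 , 9 , 1000 , s≤s z≤n , s≤s z≤n , s≤s z≤n , λ k ℓ k≥3 ℓ≥2 →
  upperBound k ℓ (ℕ.≤-trans (s≤s z≤n) k≥3) (ℕ.<⇒≤ ℓ≥2) , λ m → lowerBound k ℓ m k≥3 ℓ≥2
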